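{- Fix an integer $l\geq -1$. For all integers $g\geq 4l+3$, \[ \#\{S\in\mathcal{S}_g\mid e(S)=g-l\}=\sum_{k=-1}^{l}\ \sum_{\substack{\overline{x}\in\mathcal{Y}(k)\\ a(\overline{x})+b(\overline{x})-c(\overline{x})=2k+1-l}}\binom{g-3k-2}{k+1-a(\overline{x})-2b(\overline{x})}. \]
   Context: A numerical semigroup $S$ is a submonoid of $\mathbb{N}_0$ with finite complement; its genus is $|\mathbb{N}_0\setminus S|$ and its embedding dimension $e(S)$ is the size of its minimal generating set $(S\setminus\{0\})\setminus((S\setminus\{0\})+(S\setminus\{0\}))$. $\mathcal{S}_g$ is the finite set of numerical semigroups of genus $g$. For $\overline{x}=(x_1,\ldots,x_t)\in\{1,2,3\}^t$ let $a(\overline{x})=\#\{i\in[1,t]\mid x_i=2\}$, $b(\overline{x})=\#\{i\in[1,t]\mid x_i=3\}$, and $c(\overline{x})=\#\{i\in[1,t]\mid \exists j_1,j_2\in[1,t]:\ j_1+j_2=i,\ (x_{j_1},x_{j_2},x_i)=(1,1,2)\}$. For $k\ge -1$, $\mathcal{Y}(k)$ is the set of tuples $\overline{x}=(x_1,\ldots,x_{2k+1})\in\{1,2,3\}^{2k+1}$ (so $\mathcal{Y}(-1)$ consists of the empty tuple) such that (i) whenever $i_1,i_2,i_3\in[1,2k+1]$ with $i_1+i_2=i_3$ we have $(x_{i_1},x_{i_2},x_{i_3})\neq(1,1,3)$, and (ii) $a(\overline{x})+2b(\overline{x})\le k+1$.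
   Formalization: The genus g is taken to be a nonnegative integer; this excludes only l = -1, g = -1, where the printed formula fails because there is no semigroup of genus -1 (left side 0) while the right side equals binom(0,0) = 1. -}

module Defs where

open import Data.Nat using (ℕ; zero; suc; _+_; _*_; _∸_; _<_; _≤_)
open import Data.Nat.Combinatorics using (_C_)
open import Data.Bool using (Bool; true; false; _∧_; _∨_; if_then_else_)
open import Data.List using (List; []; _∷_; length; map; filter; concatMap; applyUpTo)
open import Data.Nat.ListAction using (sum)
open import Data.Bool.ListAction using (any)
open import Data.List.Relation.Unary.Unique.Propositional using (Unique)
open import Data.List.Relation.Unary.Linked using (Linked)
open import Data.List.Relation.Unary.All using (All)
open import Data.List.Membership.Propositional using (_∈_; _∉_)
open import Data.Maybe using (Maybe; just; nothing)
open import Data.Product using (Σ; ∃; _×_; _,_)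
open import Data.Empty using (⊥)
open import Relation.Nullary using (¬_)
open import Relation.Binary.PropositionalEquality using (_≡_; _≢_)
open import Function.Bundles using (_⇔_)
open import Relation.Nullary.Decidable using (⌊_⌋)
import Data.Nat as N

HasCard : {A : Set} → (A → Set) → ℕ → Set
HasCard {A} P n =
  Σ (List A) λ xs → Unique xs × (∀ x → (x ∈ xs) ⇔ P x) × length xs ≡ n

-- Numerical semigroups, represented by their (finite) set of gaps
-- ℕ₀ ∖ S, written as a strictly increasing list (canonical
-- representation of a finite subset of ℕ).  S = {n | n ∉ G}.

IsNumSgpGaps : List ℕ → Set
IsNumSgpGaps G =
  Linked _<_ G
  × 0 ∉ G
  × (∀ x y → x ∉ G → y ∉ G → (x + y) ∉ G)

genus : List ℕ → ℕ
genus = length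

MinGen : List ℕ → ℕ → Set
MinGen G s =
  s ≢ 0 × s ∉ G
  × ¬ (Σ ℕ λ x → Σ ℕ λ y → x ≢ 0 × y ≢ 0 × x ∉ G × y ∉ G × x + y ≡ s)

EmbDim : List ℕ → ℕ → Set
EmbDim G n = HasCard (MinGen G) n

data D : Set where
  d1 d2 d3 : D

_==D_ : D → D → Bool
d1 ==D d1 = true
d2 ==D d2 = true
d3 ==D d3 = true
_ ==D _ = false

-- 1-based lookup: at x i = just x_i for i ∈ [1,t], nothing otherwise.
at : List D → ℕ → Maybe D
at [] _ = nothing
at (x ∷ xs) zero = nothing
at (x ∷ xs) (suc zero) = just x
at (x ∷ xs) (suc (suc i)) = at xs (suc i)

is : Maybe D → D → Bool
is (just x) d = x ==D d
is nothing d = false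

range : ℕ → List ℕ
range t = applyUpTo suc t

allTuples : ℕ → List (List D)
allTuples zero = [] ∷ []
allTuples (suc t) = concatMap (λ xs → (d1 ∷ xs) ∷ (d2 ∷ xs) ∷ (d3 ∷ xs) ∷ []) (allTuples t)

count : (D → Bool) → List D → ℕ
count p xs = length (filter (λ x → Data.Bool._≟_ (p x) true) xs)

aT : List D → ℕ
aT = count (_==D d2)

bT : List D → ℕ
bT = count (_==D d3)

cT : List D → ℕ
cT x = length (filter (λ i → Data.Bool._≟_ (hit i) true) (range t))
  where
  t = length x
  hit : ℕ → Bool
  hit i = is (at x i) d2 ∧
    any (λ j1 → any (λ j2 → ⌊ j1 + j2 N.≟ i ⌋ ∧ is (at x j1) d1 ∧ is (at x j2) d1) (range t)) (range t)

-- condition (i): no i1+i2=i3 in [1,t] with (x_i1,x_i2,x_i3) = (1,1,3)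
-- (at returns nothing when i1+i2 > t, so only i3 ∈ [1,t] is checked)
has113 : List D → Bool
has113 x = any (λ i1 → any (λ i2 → is (at x i1) d1 ∧ is (at x i2) d1 ∧ is (at x (i1 + i2)) d3)
                          (range (length x))) (range (length x))

-- Y(k) with the shift j = k+1 ≥ 0: tuples of length 2k+1 = 2j ∸ 1
-- (j = 0, i.e. k = -1, gives the empty tuple), satisfying (i) and
-- (ii) a + 2b ≤ k+1 = j.
Ylist : ℕ → List (List D)
Ylist j = filter (λ x → Data.Bool._≟_ (Data.Bool.not (has113 x) ∧ ⌊ aT x + 2 * bT x N.≤? j ⌋) true)
                 (allTuples (2 * j ∸ 1))

-- Right-hand side, with L = l+1 and k = j-1 (j ∈ [0,L]):
--   a+b-c = 2k+1-l   ⇔   a + b + L = 2j + c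
--   binom(g-3k-2, k+1-a-2b) = binom(g+1-3j, j-a-2b)
inner : ℕ → ℕ → ℕ → ℕ
inner L g j = sum (map (λ x → (g + 1 ∸ 3 * j) C (j ∸ (aT x + 2 * bT x)))
                   (filter (λ x → aT x + bT x + L N.≟ 2 * j + cT x) (Ylist j)))

rhs : ℕ → ℕ → ℕ
rhs L g = sum (map (inner L g) (applyUpTo (λ j → j) (suc L)))

{-# OPTIONS --safe #-}

-- A semigroup of genus g and multiplicity m is encoded by its Kunz word w of length m - 1, whose
-- i-th letter is the number of gaps congruent to i mod m.  Put j = g + 1 - m, the number of gaps above m.
-- Distinct minimal generators are incongruent mod m, so e(S) = g - l forces j ≤ l + 1, and g ≥ 4l + 3
-- gives m ≥ 3j.  For a gap N one element of every pair {s, N - s} is a gap, so N ≤ 2g - 1;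
-- hence all letters are at most 3 and the letter 3 occurs only among the first 2j - 1 positions.
-- A minimal generator N is at most 2g + 1 by the same pairing, so it is m, or m + i with w_i = 1, or
-- 2m + i with w_i = 2 and no splitting i = p + q, w_p = w_q = 1.  Beyond position 2j - 1 such a splitting
-- always exists, because only j gaps exceed m.  Thus e(S) depends only on the first 2j - 1 letters, and the
-- remaining letters are an arbitrary word over {1,2} with the prescribed number of 2s.
module Submission where

open import Defs

module KunzWords where
  open import Data.Bool using (Bool; true; false; _∧_; not)
  open import Data.Bool.Properties as Boolₚ using (T-≡; T-not-≡)
  open import Data.Empty using (⊥; ⊥-elim)
  open import Data.Bool.ListAction using (any)
  open import Data.List using (List; []; _∷_; _++_; length; map; filter; concatMap; applyUpTo; upTo; take; drop)
  open import Data.List.Properties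
  open import Data.List.Membership.Propositional using (_∈_; _∉_; find; lose)
  open import Data.List.Membership.Propositional.Properties
  open import Data.List.Relation.Unary.All as All using (All; []; _∷_)
  import Data.List.Relation.Unary.All.Properties as Allₚ
  open import Data.List.Relation.Unary.AllPairs as AllPairs using (AllPairs; []; _∷_)
  import Data.List.Relation.Unary.AllPairs.Properties as AllPairsₚ
  open import Data.List.Relation.Unary.Any using (here; there)
  open import Data.List.Relation.Unary.Any.Properties using (any⁺; any⁻)
  open import Data.List.Relation.Unary.Linked.Properties using (AllPairs⇒Linked; Linked⇒AllPairs)
  open import Data.List.Relation.Unary.Unique.Propositional using (Unique)
  import Data.List.Relation.Unary.Unique.Propositional.Properties as Uniqueₚ
  open import Data.Maybe using (Maybe; just; nothing)
  open import Data.Maybe.Properties using (just-injective)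
  open import Data.Nat using (ℕ; zero; suc; _+_; _*_; _∸_; _≤_; _<_; z≤n; s≤s; _%_; _/_; _≟_; _≤?_)
  open import Data.Nat.Properties
  open import Data.Nat.Combinatorics using (_C_; nCk+nC[k+1]≡[n+1]C[k+1])
  open import Data.Nat.DivMod using (m≡m%n+[m/n]*n; m%n<n)
  open import Data.Nat.ListAction using (sum)
  open import Data.Nat.Tactic.RingSolver using (solve-∀)
  open import Data.Product using (∃; ∃₂; _×_; _,_; proj₁; proj₂)
  open import Data.Sum using (_⊎_; inj₁; inj₂)
  open import Function using (_∘_; id; case_of_)
  open import Function.Bundles using (_⇔_; mk⇔; Equivalence)
  open import Function.Construct.Composition using (_⇔-∘_)
  open import Relation.Binary.PropositionalEquality
  open import Relation.Nullary using (¬_; yes; no; contradiction)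
  open import Relation.Nullary.Decidable using (⌊_⌋; toWitness; fromWitness)
  open import Data.List.Membership.DecPropositional _≟_ using (_∈?_)

  private variable A B : Set

  -- Finite lists

  unique-⊆-length : {xs ys : List A} → Unique xs → (∀ {x} → x ∈ xs → x ∈ ys) → length xs ≤ length ys
  unique-⊆-length [] _ = z≤n
  unique-⊆-length {xs = x ∷ xs} (x∉xs ∷ uxs) sub with ∈-∃++ (sub (here refl))
  ... | as , bs , refl = begin
    suc (length xs)         ≤⟨ s≤s (unique-⊆-length uxs sub′) ⟩
    suc (length (as ++ bs)) ≡⟨ length-++-sucʳ as x bs ⟨
    length (as ++ x ∷ bs)   ∎
    where
    open ≤-Reasoning
    sub′ : ∀ {y} → y ∈ xs → y ∈ as ++ bs
    sub′ y∈ with ∈-++⁻ as (sub (there y∈))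
    ... | inj₁ p = ∈-++⁺ˡ p
    ... | inj₂ (here refl) = contradiction refl (All.lookup x∉xs y∈)
    ... | inj₂ (there p) = ∈-++⁺ʳ as p

  HasCard-unique : {P : A → Set} {m n : ℕ} → HasCard P m → HasCard P n → m ≡ n
  HasCard-unique (xs , uxs , xs⇔ , refl) (ys , uys , ys⇔ , refl) = ≤-antisym
    (unique-⊆-length uxs λ {x} → Equivalence.from (ys⇔ x) ∘ Equivalence.to (xs⇔ x))
    (unique-⊆-length uys λ {x} → Equivalence.from (xs⇔ x) ∘ Equivalence.to (ys⇔ x))

  -- Both heads are the least element of the common set, hence equal, and the tails follow by
  -- recursion. Gap sets can therefore be compared by membership alone.
  sorted-ext : {xs ys : List ℕ} → AllPairs _<_ xs → AllPairs _<_ ys →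
    (∀ {x} → x ∈ xs → x ∈ ys) → (∀ {x} → x ∈ ys → x ∈ xs) → xs ≡ ys
  sorted-ext [] [] _ _ = refl
  sorted-ext [] (_ ∷ _) _ sup with () ← sup (here refl)
  sorted-ext (_ ∷ _) [] sub _ with () ← sub (here refl)
  sorted-ext {x ∷ xs} {y ∷ ys} (x< ∷ sxs) (y< ∷ sys) sub sup = cong₂ _∷_ x≡y (sorted-ext sxs sys sub′ sup′)
    where
    x≡y : x ≡ y
    x≡y with sub (here refl) | sup (here refl)
    ... | here e  | _       = e
    ... | there p | here e  = sym e
    ... | there p | there q = contradiction (All.lookup x< q) (<-asym (All.lookup y< p))
    sub′ : ∀ {z} → z ∈ xs → z ∈ ys
    sub′ z∈ with sub (there z∈)
    ... | there p   = p
    ... | here refl = contradiction (All.lookup x< z∈) (<-irrefl x≡y)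
    sup′ : ∀ {z} → z ∈ ys → z ∈ xs
    sup′ z∈ with sup (there z∈)
    ... | there p   = p
    ... | here refl = contradiction (All.lookup y< z∈) (<-irrefl (sym x≡y))

  length-concatMap : (f : A → List B) (xs : List A) → length (concatMap f xs) ≡ sum (map (length ∘ f) xs)
  length-concatMap f [] = refl
  length-concatMap f (x ∷ xs) = trans (length-++ (f x)) (cong (length (f x) +_) (length-concatMap f xs))

  sum-map-cong : {f h : A → ℕ} (xs : List A) → (∀ {x} → x ∈ xs → f x ≡ h x) → sum (map f xs) ≡ sum (map h xs)
  sum-map-cong [] _ = refl
  sum-map-cong (x ∷ xs) eq = cong₂ _+_ (eq (here refl)) (sum-map-cong xs (eq ∘ there))

  ∈-concatMap⁺′ : {f : A → List B} {xs : List A} {x : A} {y : B} → x ∈ xs → y ∈ f x → y ∈ concatMap f xs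
  ∈-concatMap⁺′ {f = f} x∈ y∈ = ∈-concatMap⁺ f (lose x∈ y∈)

  ∈-concatMap⁻′ : (f : A → List B) (xs : List A) {y : B} → y ∈ concatMap f xs → ∃ λ x → x ∈ xs × y ∈ f x
  ∈-concatMap⁻′ f xs y∈ = find (∈-concatMap⁻ f {xs = xs} y∈)

  -- Since `label` recovers from an element the index of its block, blocks with different indices
  -- are disjoint.
  concatMap-unique : {f : A → List B} (label : B → A) {xs : List A} → Unique xs →
    (∀ {x} → x ∈ xs → Unique (f x)) → (∀ {x y} → x ∈ xs → y ∈ f x → label y ≡ x) → Unique (concatMap f xs)
  concatMap-unique label [] _ _ = []
  concatMap-unique {f = f} label {x ∷ xs} (x∉ ∷ uxs) ufs lab =
    Uniqueₚ.++⁺ (ufs (here refl)) (concatMap-unique label uxs (ufs ∘ there) (lab ∘ there)) disjoint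
    where
    disjoint : ∀ {y} → ¬ (y ∈ f x × y ∈ concatMap f xs)
    disjoint (p , q) with ∈-concatMap⁻′ f xs q
    ... | x′ , x′∈ , r = All.lookup x∉ x′∈ (trans (sym (lab (here refl) p)) (lab (there x′∈) r))

  -- Whatever H misses in [0, N] is the reflection s ↦ N ∸ s of an element of H.
  half-cover-∈ : {H : List ℕ} {N : ℕ} → N ∈ H → (∀ {s} → 1 ≤ s → s < N → s ∈ H ⊎ (N ∸ s) ∈ H) → suc N ≤ 2 * length H
  half-cover-∈ {H} {N} N∈ cover = begin
    suc N                            ≡⟨ length-applyUpTo id (suc N) ⟨
    length (upTo (suc N))            ≤⟨ unique-⊆-length (Uniqueₚ.upTo⁺ (suc N)) sub ⟩
    length (H ++ map (N ∸_) H)       ≡⟨ length-++ H ⟩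
    length H + length (map (N ∸_) H) ≡⟨ cong (length H +_) (length-map _ H) ⟩
    length H + length H              ≡⟨ cong (length H +_) (+-identityʳ _) ⟨
    2 * length H                     ∎
    where
    open ≤-Reasoning
    reflect : ∀ {s} → s ≤ N → (N ∸ s) ∈ H → s ∈ map (N ∸_) H
    reflect s≤N p = subst (_∈ map (N ∸_) H) (m∸[m∸n]≡n s≤N) (∈-map⁺ (N ∸_) p)
    sub : ∀ {s} → s ∈ upTo (suc N) → s ∈ H ++ map (N ∸_) H
    sub {zero} _ = ∈-++⁺ʳ H (reflect z≤n N∈)
    sub {suc s} s∈ with m≤n⇒m<n∨m≡n (≤-pred (∈-upTo⁻ s∈))
    ... | inj₂ refl = ∈-++⁺ˡ N∈
    ... | inj₁ s<N with cover (s≤s z≤n) s<N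
    ... | inj₁ p = ∈-++⁺ˡ p
    ... | inj₂ p = ∈-++⁺ʳ H (reflect (<⇒≤ s<N) p)

  -- Adjoining N to H reduces to `half-cover-∈`. This form suits minimal generators, which are not
  -- gaps themselves.
  half-cover : {H : List ℕ} {N : ℕ} → (∀ {s} → 1 ≤ s → s < N → s ∈ H ⊎ (N ∸ s) ∈ H) → N ≤ suc (2 * length H)
  half-cover {H} {N} cover = ≤-pred (subst (suc N ≤_) (*-suc 2 (length H))
    (half-cover-∈ {N ∷ H} (here refl) λ 1≤s s<N → case cover 1≤s s<N of λ where
      (inj₁ p) → inj₁ (there p)
      (inj₂ p) → inj₂ (there p)))

  -- Words over {1,2,3}

  ∈-range⁺ : ∀ {i n} → 1 ≤ i → i ≤ n → i ∈ range n
  ∈-range⁺ (s≤s z≤n) i≤n = ∈-applyUpTo⁺ suc i≤n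

  ∈-range⁻ : ∀ {i n} → i ∈ range n → 1 ≤ i × i ≤ n
  ∈-range⁻ i∈ with ∈-applyUpTo⁻ suc i∈
  ... | _ , i<n , refl = s≤s z≤n , i<n

  range-sorted : ∀ n → AllPairs _<_ (range n)
  range-sorted n = AllPairsₚ.applyUpTo⁺₁ suc n λ i<j _ → s≤s i<j

  select : (ℕ → Bool) → ℕ → List ℕ
  select q n = filter (λ i → Boolₚ._≟_ (q i) true) (range n)

  ∈-select⁺ : ∀ q n {i} → 1 ≤ i → i ≤ n → q i ≡ true → i ∈ select q n
  ∈-select⁺ q n 1≤i i≤n = ∈-filter⁺ (λ i → Boolₚ._≟_ (q i) true) (∈-range⁺ 1≤i i≤n)

  ∈-select⁻ : ∀ q n {i} → i ∈ select q n → (1 ≤ i × i ≤ n) × q i ≡ true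
  ∈-select⁻ q n i∈ with ∈-filter⁻ (λ i → Boolₚ._≟_ (q i) true) {xs = range n} i∈
  ... | i∈r , qi = ∈-range⁻ i∈r , qi

  select-sorted : ∀ q n → AllPairs _<_ (select q n)
  select-sorted q n = AllPairsₚ.filter⁺ (λ i → Boolₚ._≟_ (q i) true) (range-sorted n)

  length-select-split : (u v : ℕ → Bool) (n : ℕ) →
    length (select (λ i → u i ∧ v i) n) + length (select (λ i → u i ∧ not (v i)) n) ≡ length (select u n)
  length-select-split u v n = go (range n)
    where
    go : ∀ is → length (filter (λ i → Boolₚ._≟_ (u i ∧ v i) true) is)
              + length (filter (λ i → Boolₚ._≟_ (u i ∧ not (v i)) true) is)
              ≡ length (filter (λ i → Boolₚ._≟_ (u i) true) is)
    go [] = refl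
    go (i ∷ is) with u i | v i
    ... | false | _     = go is
    ... | true  | true  = cong suc (go is)
    ... | true  | false = trans (+-suc _ _) (cong suc (go is))

  length-select-at : (p : Maybe D → Bool) (w : List D) →
    length (select (λ i → p (at w i)) (length w)) ≡ count (p ∘ just) w
  length-select-at p w = go w suc (λ _ → refl)
    where
    -- Removing a letter shifts all positions, so the enumeration `f` of the positions is
    -- generalised.
    go : ∀ v {q : ℕ → Bool} (f : ℕ → ℕ) → (∀ i → q (f i) ≡ p (at v (suc i))) →
      length (filter (λ i → Boolₚ._≟_ (q i) true) (applyUpTo f (length v))) ≡ count (p ∘ just) v
    go [] f eq = refl
    go (d ∷ v) {q} f eq with q (f 0) | eq 0
    ... | b | refl with p (just d)
    ... | true  = cong suc (go v (f ∘ suc) (eq ∘ suc))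
    ... | false = go v (f ∘ suc) (eq ∘ suc)

  at-++ˡ : ∀ x {t i} → i ≤ length x → at (x ++ t) i ≡ at x i
  at-++ˡ [] {[]} z≤n = refl
  at-++ˡ [] {_ ∷ _} z≤n = refl
  at-++ˡ (_ ∷ _) {i = zero} _ = refl
  at-++ˡ (_ ∷ _) {i = suc zero} _ = refl
  at-++ˡ (_ ∷ x) {i = suc (suc i)} (s≤s i≤) = at-++ˡ x i≤

  at-++ʳ : ∀ x {t} i → at (x ++ t) (length x + suc i) ≡ at t (suc i)
  at-++ʳ [] i = refl
  at-++ʳ (_ ∷ x) {t} i with length x + suc i | +-suc (length x) i | at-++ʳ x {t} i
  ... | _ | refl | eq = eq

  at-range : ∀ w {i d} → at w i ≡ just d → 1 ≤ i × i ≤ length w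
  at-range (_ ∷ _) {suc zero} _ = s≤s z≤n , s≤s z≤n
  at-range (_ ∷ w) {suc (suc i)} eq = s≤s z≤n , s≤s (proj₂ (at-range w eq))

  at-defined : ∀ w {i} → 1 ≤ i → i ≤ length w → ∃ λ d → at w i ≡ just d
  at-defined (d ∷ _) {suc zero} _ _ = d , refl
  at-defined (_ ∷ w) {suc (suc i)} _ (s≤s i≤) = at-defined w (s≤s z≤n) i≤

  at-applyUpTo : ∀ (f : ℕ → D) {n i} → i < n → at (applyUpTo f n) (suc i) ≡ just (f i)
  at-applyUpTo f {suc n} {zero} _ = refl
  at-applyUpTo f {suc n} {suc i} (s≤s i<n) = at-applyUpTo (f ∘ suc) i<n

  at-ext : ∀ {u v} → length u ≡ length v → (∀ {i d} → at u i ≡ just d → at v i ≡ just d) → u ≡ v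
  at-ext {[]} {[]} _ _ = refl
  at-ext {d ∷ u} {e ∷ v} len sub = cong₂ _∷_ (sym (just-injective (sub {1} refl)))
    (at-ext (suc-injective len) λ {i} → tails i)
    where
    tails : ∀ i {d} → at u i ≡ just d → at v i ≡ just d
    tails zero eq with () ← proj₁ (at-range u eq)
    tails (suc i) eq = sub {suc (suc i)} eq

  is-true⁺ : ∀ {m d} → m ≡ just d → is m d ≡ true
  is-true⁺ {d = d1} refl = refl
  is-true⁺ {d = d2} refl = refl
  is-true⁺ {d = d3} refl = refl

  is-true⁻ : ∀ {m d} → is m d ≡ true → m ≡ just d
  is-true⁻ {just d1} {d1} _ = refl
  is-true⁻ {just d2} {d2} _ = refl
  is-true⁻ {just d3} {d3} _ = refl

  any-true⁺ : ∀ {p : A → Bool} {xs x} → x ∈ xs → p x ≡ true → any p xs ≡ true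
  any-true⁺ {p = p} x∈ px = Equivalence.to T-≡ (any⁺ p (lose x∈ (Equivalence.from T-≡ px)))

  any-true⁻ : ∀ (p : A → Bool) xs → any p xs ≡ true → ∃ λ x → x ∈ xs × p x ≡ true
  any-true⁻ p xs eq with find (any⁻ p xs (Equivalence.from T-≡ eq))
  ... | x , x∈ , px = x , x∈ , Equivalence.to T-≡ px

  ∧-true⁺ : ∀ {a b} → a ≡ true → b ≡ true → a ∧ b ≡ true
  ∧-true⁺ refl refl = refl

  ∧-true⁻ : ∀ {a b} → a ∧ b ≡ true → a ≡ true × b ≡ true
  ∧-true⁻ {true} {true} _ = refl , refl

  -- This repeats the second conjunct of `hit` in `cT` literally, so that `cT x` unfolds to the
  -- number of positions with letter 2 that split.
  splits : List D → ℕ → Bool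
  splits x i = any (λ p → any (λ q → ⌊ p + q ≟ i ⌋ ∧ is (at x p) d1 ∧ is (at x q) d1) (range (length x)))
                   (range (length x))

  splits⁺ : ∀ x {p q} → at x p ≡ just d1 → at x q ≡ just d1 → splits x (p + q) ≡ true
  splits⁺ x {p} {q} xp xq =
    any-true⁺ (inRange xp) (any-true⁺ (inRange xq)
      (∧-true⁺ (Equivalence.to T-≡ (fromWitness {a? = p + q ≟ p + q} refl)) (∧-true⁺ (is-true⁺ xp) (is-true⁺ xq))))
    where
    inRange : ∀ {i} → at x i ≡ just d1 → i ∈ range (length x)
    inRange xi with at-range x xi
    ... | 1≤i , i≤ = ∈-range⁺ 1≤i i≤

  splits⁻ : ∀ x {i} → splits x i ≡ true → ∃₂ λ p q → p + q ≡ i × at x p ≡ just d1 × at x q ≡ just d1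
  splits⁻ x {i} eq with any-true⁻ _ (range (length x)) eq
  ... | p , _ , eq₁ with any-true⁻ _ (range (length x)) eq₁
  ... | q , _ , eq₂ with ∧-true⁻ eq₂
  ... | s , eq₃ with ∧-true⁻ eq₃
  ... | xp , xq = p , q , toWitness {a? = p + q ≟ i} (Equivalence.from T-≡ s) , is-true⁻ xp , is-true⁻ xq

  has113⁺ : ∀ x {p q} → at x p ≡ just d1 → at x q ≡ just d1 → at x (p + q) ≡ just d3 → has113 x ≡ true
  has113⁺ x xp xq xr with at-range x xp | at-range x xq
  ... | 1≤p , p≤ | 1≤q , q≤ = any-true⁺ (∈-range⁺ 1≤p p≤) (any-true⁺ (∈-range⁺ 1≤q q≤)
    (∧-true⁺ (is-true⁺ xp) (∧-true⁺ (is-true⁺ xq) (is-true⁺ xr))))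

  has113⁻ : ∀ x → has113 x ≡ true → ∃₂ λ p q → at x p ≡ just d1 × at x q ≡ just d1 × at x (p + q) ≡ just d3
  has113⁻ x eq with any-true⁻ _ (range (length x)) eq
  ... | p , _ , eq₁ with any-true⁻ _ (range (length x)) eq₁
  ... | q , _ , eq₂ with ∧-true⁻ eq₂
  ... | xp , eq₃ with ∧-true⁻ eq₃
  ... | xq , xr = p , q , is-true⁻ xp , is-true⁻ xq , is-true⁻ xr

  -- The positions with letter 2 divide into those that split, counted by `cT`, and the others,
  -- which will be the generators between 2m and 3m.
  cT-unsplit : ∀ x → cT x + length (select (λ i → is (at x i) d2 ∧ not (splits x i)) (length x)) ≡ aT x
  cT-unsplit x = trans (length-select-split (λ i → is (at x i) d2) (splits x) (length x))
                       (length-select-at (λ m → is m d2) x)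

  -- Semigroups from Kunz words

  large : Maybe D → Bool
  large (just d1) = false
  large (just d2) = true
  large (just d3) = true
  large nothing   = false

  large⁺ : ∀ {m d} → m ≡ just d → d ≢ d1 → large m ≡ true
  large⁺ {d = d1} refl d≢d1 = contradiction refl d≢d1
  large⁺ {d = d2} refl _ = refl
  large⁺ {d = d3} refl _ = refl

  large⁻ : ∀ {m} → large m ≡ true → ∃ λ d → m ≡ just d × d ≢ d1
  large⁻ {just d2} _ = d2 , refl , λ ()
  large⁻ {just d3} _ = d3 , refl , λ ()

  mult : List D → ℕ
  mult w = suc (length w)

  larges : List D → List ℕ
  larges w = select (λ i → large (at w i)) (length w)

  threes : List D → List ℕ
  threes w = select (λ i → is (at w i) d3) (length w)

  -- With m = `mult w`, a letter d at position i stands for the first d numbers among i, m + i, 2m +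
  -- i. The constructors sort these gaps by their quotient by m.
  data IsGap (w : List D) : ℕ → Set where
    low  : ∀ {i} → 1 ≤ i → i ≤ length w → IsGap w i
    mid  : ∀ {i d} → at w i ≡ just d → d ≢ d1 → IsGap w (mult w + i)
    high : ∀ {i} → at w i ≡ just d3 → IsGap w (mult w + mult w + i)

  -- The blocks lie in [0, m], in (m, 2m] and above 2m. Both the gaps and the minimal generators are
  -- listed in this shape.
  sorted-three-blocks : ∀ {m xs ys zs} → AllPairs _<_ xs → AllPairs _<_ ys → AllPairs _<_ zs →
    All (_≤ m) xs → All (λ y → 1 ≤ y × y ≤ m) ys → All (1 ≤_) zs →
    AllPairs _<_ (xs ++ (map (m +_) ys ++ map (m + m +_) zs))
  sorted-three-blocks {m} {xs} {ys} {zs} sxs sys szs bxs bys bzs = AllPairsₚ.++⁺ sxs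
    (AllPairsₚ.++⁺ (AllPairsₚ.map⁺ (AllPairs.map (+-monoʳ-< m) sys))
                   (AllPairsₚ.map⁺ (AllPairs.map (+-monoʳ-< (m + m)) szs))
                   (Allₚ.map⁺ (All.map (λ (_ , y≤) → Allₚ.map⁺ (All.map (λ 1≤z → y<z y≤ 1≤z) bzs)) bys)))
    (All.map (λ x≤m → Allₚ.++⁺ (Allₚ.map⁺ (All.map (λ (1≤y , _) → ≤-<-trans x≤m (m<m+n m 1≤y)) bys))
                               (Allₚ.map⁺ (All.map (λ 1≤z → ≤-<-trans x≤m (≤-<-trans (m≤m+n m m) (m<m+n (m + m) 1≤z))) bzs))) bxs)
    where
    y<z : ∀ {y z} → y ≤ m → 1 ≤ z → m + y < m + m + z
    y<z y≤m 1≤z = ≤-<-trans (+-monoʳ-≤ m y≤m) (m<m+n (m + m) 1≤z)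

  select-bounds : ∀ q n → All (λ i → 1 ≤ i × i ≤ n) (select q n)
  select-bounds q n = All.tabulate (proj₁ ∘ ∈-select⁻ q n)

  count-large : ∀ w → count (large ∘ just) w ≡ aT w + bT w
  count-large [] = refl
  count-large (d1 ∷ w) = count-large w
  count-large (d2 ∷ w) = cong suc (count-large w)
  count-large (d3 ∷ w) = trans (cong suc (count-large w)) (sym (+-suc _ _))

  count-partition : ∀ w → count (_==D d1) w + (aT w + bT w) ≡ length w
  count-partition [] = refl
  count-partition (d1 ∷ w) = cong suc (count-partition w)
  count-partition (d2 ∷ w) = trans (+-suc _ _) (cong suc (count-partition w))
  count-partition (d3 ∷ w) = trans (cong (count (_==D d1) w +_) (+-suc (aT w) (bT w))) (trans (+-suc _ _) (cong suc (count-partition w)))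

  length-larges : ∀ w → length (larges w) ≡ aT w + bT w
  length-larges w = trans (length-select-at large w) (count-large w)

  opaque
    -- The gaps of the semigroup of multiplicity length w + 1 whose i-th Kunz coordinate
    -- (the number of gaps congruent to i) is the i-th entry of w.
    gaps : List D → List ℕ
    gaps w = range (length w) ++ (map (mult w +_) (larges w) ++ map (mult w + mult w +_) (threes w))

    ∈-gaps⁺ : ∀ {w y} → IsGap w y → y ∈ gaps w
    ∈-gaps⁺ (low 1≤i i≤) = ∈-++⁺ˡ (∈-range⁺ 1≤i i≤)
    ∈-gaps⁺ {w} (mid wi d≢) with at-range w wi
    ... | 1≤i , i≤ = ∈-++⁺ʳ (range (length w)) (∈-++⁺ˡ (∈-map⁺ (mult w +_) (∈-select⁺ (λ i → large (at w i)) (length w) 1≤i i≤ (large⁺ wi d≢))))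
    ∈-gaps⁺ {w} (high wi) with at-range w wi
    ... | 1≤i , i≤ = ∈-++⁺ʳ (range (length w)) (∈-++⁺ʳ (map (mult w +_) (larges w))
                       (∈-map⁺ (mult w + mult w +_) (∈-select⁺ (λ i → is (at w i) d3) (length w) 1≤i i≤ (is-true⁺ wi))))

    ∈-gaps⁻ : ∀ {w y} → y ∈ gaps w → IsGap w y
    ∈-gaps⁻ {w} y∈ with ∈-++⁻ (range (length w)) y∈
    ... | inj₁ p with ∈-range⁻ p
    ... | 1≤i , i≤ = low 1≤i i≤
    ∈-gaps⁻ {w} y∈ | inj₂ p with ∈-++⁻ (map (mult w +_) (larges w)) p
    ... | inj₁ q with ∈-map⁻ (mult w +_) q
    ... | i , i∈ , refl with large⁻ (proj₂ (∈-select⁻ (λ i → large (at w i)) (length w) i∈))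
    ... | _ , wi , d≢ = mid wi d≢
    ∈-gaps⁻ {w} y∈ | inj₂ p | inj₂ q with ∈-map⁻ (mult w + mult w +_) q
    ... | i , i∈ , refl = high (is-true⁻ (proj₂ (∈-select⁻ (λ i → is (at w i) d3) (length w) i∈)))

    gaps-sorted : ∀ w → AllPairs _<_ (gaps w)
    gaps-sorted w = sorted-three-blocks (range-sorted (length w))
      (select-sorted (λ i → large (at w i)) (length w)) (select-sorted (λ i → is (at w i) d3) (length w))
      (All.tabulate (m≤n⇒m≤1+n ∘ proj₂ ∘ ∈-range⁻))
      (All.map (λ (1≤i , i≤) → 1≤i , m≤n⇒m≤1+n i≤) (select-bounds (λ i → large (at w i)) (length w)))
      (All.map proj₁ (select-bounds (λ i → is (at w i) d3) (length w)))

    length-gaps : ∀ w → length (gaps w) ≡ length w + (aT w + 2 * bT w)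
    length-gaps w = begin
      length (gaps w)
        ≡⟨ length-++ (range (length w)) ⟩
      length (range (length w)) + length (map (mult w +_) (larges w) ++ map (mult w + mult w +_) (threes w))
        ≡⟨ cong₂ _+_ (length-applyUpTo suc (length w)) (length-++ (map (mult w +_) (larges w))) ⟩
      length w + (length (map (mult w +_) (larges w)) + length (map (mult w + mult w +_) (threes w)))
        ≡⟨ cong (length w +_) (cong₂ _+_ (trans (length-map _ (larges w)) (length-larges w))
                                         (trans (length-map _ (threes w)) (length-select-at (λ m → is m d3) w))) ⟩
      length w + (aT w + bT w + bT w)
        ≡⟨ rearrange (length w) (aT w) (bT w) ⟩
      length w + (aT w + 2 * bT w) ∎
      where
      open ≡-Reasoning
      rearrange : ∀ n a b → n + (a + b + b) ≡ n + (a + 2 * b)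
      rearrange = solve-∀

  -- The quotient by m, cut off at 3: every gap and every minimal generator in question turns out to
  -- lie below 3m.
  data Level (m : ℕ) : ℕ → Set where
    level₀ : ∀ {i} → i < m → Level m i
    level₁ : ∀ {i} → i < m → Level m (m + i)
    level₂ : ∀ {i} → i < m → Level m (m + m + i)
    above  : ∀ i → Level m (m + m + m + i)

  level : ∀ m y → Level m y
  level m y with <-≤-connex y m
  ... | inj₁ y<m = level₀ y<m
  ... | inj₂ m≤y with m≤n⇒∃[o]m+o≡n m≤y
  ... | y′ , refl with <-≤-connex y′ m
  ... | inj₁ y<m = level₁ y<m
  ... | inj₂ m≤y′ with m≤n⇒∃[o]m+o≡n m≤y′
  ... | y″ , refl with <-≤-connex y″ m
  ... | inj₁ y<m = subst (Level m) (+-assoc m m y″) (level₂ y<m)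
  ... | inj₂ m≤y″ with m≤n⇒∃[o]m+o≡n m≤y″
  ... | i , refl = subst (Level m) (trans (+-assoc (m + m) m i) (+-assoc m m (m + i))) (above i)

  gap-low : ∀ {w i} → 1 ≤ i → i < mult w → i ∈ gaps w
  gap-low 1≤i (s≤s i≤) = ∈-gaps⁺ (low 1≤i i≤)

  0∉gaps : ∀ {w} → 0 ∉ gaps w
  0∉gaps {w} 0∈ = absurd (∈-gaps⁻ 0∈) refl
    where
    absurd : ∀ {y} → IsGap w y → y ≢ 0
    absurd (low () _) refl

  gap-mid⁻ : ∀ {w i} → i < mult w → mult w + i ∈ gaps w → ∃ λ d → at w i ≡ just d × d ≢ d1
  gap-mid⁻ {w} {i} i<m p = go (∈-gaps⁻ p) refl
    where
    -- The number is replaced by a variable with an equation so that `IsGap` can be matched. The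
    -- bound i < m excludes a second reading as 2m + i′.
    go : ∀ {y} → IsGap w y → y ≡ mult w + i → ∃ λ d → at w i ≡ just d × d ≢ d1
    go (low _ y≤) refl = contradiction (≤-trans (m≤m+n (mult w) i) y≤) (n≮n _)
    go (mid {i′} wi d≢) eq with refl ← +-cancelˡ-≡ (mult w) i′ i eq = _ , wi , d≢
    go (high {i′} wi) eq = contradiction
      (subst (_< mult w) (sym (+-cancelˡ-≡ (mult w) _ _ (trans (sym (+-assoc (mult w) (mult w) i′)) eq))) i<m)
      (m+n≮m (mult w) i′)

  gap-high⁻ : ∀ {w i} → mult w + mult w + i ∈ gaps w → at w i ≡ just d3
  gap-high⁻ {w} {i} p = go (∈-gaps⁻ p) refl
    where
    go : ∀ {y} → IsGap w y → y ≡ mult w + mult w + i → at w i ≡ just d3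
    go (low _ y≤) refl = contradiction (≤-trans (≤-trans (m≤m+n (mult w) (mult w)) (m≤m+n _ i)) y≤) (n≮n _)
    go (mid {i′} wi _) eq = contradiction
      (subst (_≤ length w) (+-cancelˡ-≡ (mult w) _ _ (trans eq (+-assoc (mult w) (mult w) i))) (proj₂ (at-range w wi)))
      (λ le → n≮n _ (≤-trans (m≤m+n (mult w) i) le))
    go (high {i′} wi) eq with refl ← +-cancelˡ-≡ (mult w + mult w) i′ i eq = wi

  at-length<mult : ∀ w {i d} → at w i ≡ just d → i < mult w
  at-length<mult w wi = s≤s (proj₂ (at-range w wi))

  at-functional : ∀ w {i d e} → at w i ≡ just d → at w i ≡ just e → d ≡ e
  at-functional w p q = just-injective (trans (sym p) q)

  mid∉gaps : ∀ {w i} → at w i ≡ just d1 → mult w + i ∉ gaps w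
  mid∉gaps {w} wi p with gap-mid⁻ (at-length<mult w wi) p
  ... | _ , wi′ , d≢ = d≢ (at-functional w wi′ wi)

  high∉gaps : ∀ {w i d} → at w i ≡ just d → d ≢ d3 → mult w + mult w + i ∉ gaps w
  high∉gaps {w} wi d≢ p = d≢ (at-functional w wi (gap-high⁻ p))

  -- Written as m + 0, the multiplicity could be a gap only through a letter at position 0, and
  -- positions start at 1.
  mult∉gaps : ∀ {w} → mult w ∉ gaps w
  mult∉gaps {w} p with gap-mid⁻ {w} {0} (s≤s z≤n) (subst (_∈ gaps w) (sym (+-identityʳ (mult w))) p)
  ... | _ , w0 , _ with () ← proj₁ (at-range w w0)

  nongap≥mult : ∀ {w y} → y ≢ 0 → y ∉ gaps w → mult w ≤ y
  nongap≥mult {w} {zero} y≢0 _ = contradiction refl y≢0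
  nongap≥mult {w} {suc y} _ y∉ = ≮⇒≥ λ y<m → y∉ (gap-low (s≤s z≤n) y<m)

  -- Neither summand is mult w itself, since the other one would then be the gap mult w + i.
  decompose : ∀ {w u v i d} → at w i ≡ just d → d ≢ d1 → u ≢ 0 → v ≢ 0 → u ∉ gaps w → v ∉ gaps w →
    u + v ≡ mult w + mult w + i → ∃₂ λ p q → p + q ≡ i × at w p ≡ just d1 × at w q ≡ just d1
  decompose {w} {i = i} wi d≢ u≢0 v≢0 u∉ v∉ eq
    with m≤n⇒∃[o]m+o≡n (nongap≥mult {w} u≢0 u∉) | m≤n⇒∃[o]m+o≡n (nongap≥mult {w} v≢0 v∉)
  ... | p , refl | q , refl = p , q , p+q≡i , one p (m≤m+n p q) u∉ p≢0 , one q (m≤n+m q p) v∉ q≢0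
    where
    rearrange : ∀ m p q → m + m + (p + q) ≡ m + p + (m + q)
    rearrange = solve-∀
    p+q≡i : p + q ≡ i
    p+q≡i = +-cancelˡ-≡ (mult w + mult w) _ _ (trans (rearrange (mult w) p q) eq)
    p≢0 : p ≢ 0
    p≢0 refl = v∉ (subst (λ k → mult w + k ∈ gaps w) (sym p+q≡i) (∈-gaps⁺ (mid wi d≢)))
    q≢0 : q ≢ 0
    q≢0 refl = u∉ (subst (λ k → mult w + k ∈ gaps w) (trans (sym p+q≡i) (+-identityʳ p)) (∈-gaps⁺ (mid wi d≢)))
    one : ∀ k → k ≤ p + q → mult w + k ∉ gaps w → k ≢ 0 → at w k ≡ just d1
    one k k≤ k∉ k≢0 with at-defined w (n≢0⇒n>0 k≢0) (≤-trans k≤ (subst (_≤ length w) (sym p+q≡i) (proj₂ (at-range w wi))))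
    ... | d1 , eq = eq
    ... | d2 , eq = contradiction (∈-gaps⁺ (mid eq λ ())) k∉
    ... | d3 , eq = contradiction (∈-gaps⁺ (mid eq λ ())) k∉

  -- Two nonzero nongaps add up to at least 2m, so their sum can only meet a gap 2m + i with letter
  -- 3. By `decompose` this would be a forbidden triple (1,1,3).
  gaps-IsNumSgpGaps : ∀ {w} → (∀ {p q} → at w p ≡ just d1 → at w q ≡ just d1 → at w (p + q) ≢ just d3) →
    IsNumSgpGaps (gaps w)
  gaps-IsNumSgpGaps {w} no113 = AllPairs⇒Linked (gaps-sorted w) , 0∉gaps {w} , closed
    where
    closed : ∀ u v → u ∉ gaps w → v ∉ gaps w → u + v ∉ gaps w
    closed zero v _ v∉ = v∉
    closed (suc u) zero u∉ _ = subst (_∉ gaps w) (sym (+-identityʳ (suc u))) u∉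
    closed (suc u) (suc v) u∉ v∉ uv∈ = go (∈-gaps⁻ uv∈) refl
      where
      2m≤ : mult w + mult w ≤ suc u + suc v
      2m≤ = +-mono-≤ (nongap≥mult {w} (λ ()) u∉) (nongap≥mult {w} (λ ()) v∉)
      go : ∀ {y} → IsGap w y → y ≡ suc u + suc v → ⊥
      go (low _ y≤) refl = n≮n _ (≤-trans (≤-trans (m≤m+n (mult w) (mult w)) 2m≤) y≤)
      go (mid wi _) eq = n≮n _ (≤-trans (+-cancelˡ-≤ (mult w) _ _ (subst (mult w + mult w ≤_) (sym eq) 2m≤)) (proj₂ (at-range w wi)))
      go (high wi) eq with decompose {w} wi (λ ()) (λ ()) (λ ()) u∉ v∉ (sym eq)
      ... | p , q , refl , wp , wq = no113 wp wq wi

  -- Minimal generators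

  -- If neither s nor y - s were a gap, they would decompose the generator y.
  mingen-cover : ∀ {G y} → MinGen G y → ∀ {s} → 1 ≤ s → s < y → s ∈ G ⊎ (y ∸ s) ∈ G
  mingen-cover {G} {y} (_ , _ , indec) {s} 1≤s s<y with s ∈? G | (y ∸ s) ∈? G
  ... | yes p | _     = inj₁ p
  ... | no _  | yes q = inj₂ q
  ... | no p  | no q  = contradiction (s , y ∸ s , m<n⇒n≢0 1≤s , m<n⇒n≢0 (m<n⇒0<n∸m s<y) , p , q , m+[n∸m]≡n (<⇒≤ s<y)) indec

  -- Two nongaps cannot add up to a gap. As y itself lies in G, the sharper `half-cover-∈` applies.
  gap-cover : ∀ {G y} → IsNumSgpGaps G → y ∈ G → ∀ {s} → 1 ≤ s → s < y → s ∈ G ⊎ (y ∸ s) ∈ G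
  gap-cover {G} {y} (_ , _ , closed) y∈ {s} 1≤s s<y with s ∈? G | (y ∸ s) ∈? G
  ... | yes p | _     = inj₁ p
  ... | no _  | yes q = inj₂ q
  ... | no p  | no q  = contradiction (subst (_∈ G) (sym (m+[n∸m]≡n (<⇒≤ s<y))) y∈) (closed s (y ∸ s) p q)

  at-++⁻ : ∀ x {t i d} → at (x ++ t) i ≡ just d → (i ≤ length x × at x i ≡ just d) ⊎ (length x < i × ∃ λ k → at t k ≡ just d)
  at-++⁻ x {t} {i} {d} eq with ≤-<-connex i (length x)
  ... | inj₁ i≤ = inj₁ (i≤ , trans (sym (at-++ˡ x i≤)) eq)
  ... | inj₂ x<i with m≤n⇒∃[o]m+o≡n x<i
  ... | k , refl = inj₂ (x<i , suc k , trans (sym (at-++ʳ x k)) (subst (λ h → at (x ++ t) h ≡ just d) (sym (+-suc (length x) k)) eq))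

  at-∈ : ∀ {w i d} → at w i ≡ just d → d ∈ w
  at-∈ {_ ∷ _} {suc zero} refl = here refl
  at-∈ {_ ∷ _} {suc (suc i)} eq = there (at-∈ {i = suc i} eq)

  count-++ : ∀ p x t → count p (x ++ t) ≡ count p x + count p t
  count-++ p x t = trans (cong length (filter-++ _ x t)) (length-++ (filter (λ d → Boolₚ._≟_ (p d) true) x))

  bT≡0 : ∀ {t} → All (_≢ d3) t → bT t ≡ 0
  bT≡0 [] = refl
  bT≡0 {d1 ∷ _} (_ ∷ a) = bT≡0 a
  bT≡0 {d2 ∷ _} (_ ∷ a) = bT≡0 a
  bT≡0 {d3 ∷ _} (d≢ ∷ _) = contradiction refl d≢

  -- j is the number of gaps above the multiplicity length (x ++ t) + 1.
  record Code (j : ℕ) (x t : List D) : Set where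
    field
      head-length : length x ≡ 2 * j ∸ 1
      no113       : has113 x ≡ false
      tail-no3    : All (_≢ d3) t
      weight      : aT x + 2 * bT x + aT t ≡ j
      long        : 3 * j ≤ mult (x ++ t)

  -- Genus and minimal generators of an encoded semigroup

  module _ {j x t} (code : Code j x t) where
    open Code code

    private
      w : List D
      w = x ++ t
      m : ℕ
      m = mult w

    aT-code : aT w ≡ aT x + aT t
    aT-code = count-++ _ x t

    bT-code : bT w ≡ bT x
    bT-code = trans (count-++ _ x t) (trans (cong (bT x +_) (bT≡0 tail-no3)) (+-identityʳ _))

    code-genus : length (gaps w) ≡ length w + j
    code-genus = trans (length-gaps w) (cong (length w +_) (begin
      aT w + 2 * bT w          ≡⟨ cong₂ (λ a b → a + 2 * b) aT-code bT-code ⟩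
      aT x + aT t + 2 * bT x   ≡⟨ rearrange (aT x) (aT t) (bT x) ⟩
      aT x + 2 * bT x + aT t   ≡⟨ weight ⟩
      j                        ∎))
      where
      open ≡-Reasoning
      rearrange : ∀ a a′ b → a + a′ + 2 * b ≡ a + 2 * b + a′
      rearrange = solve-∀

    -- A letter 3 sits in the head, and then so do the positions p and q, which are no larger;
    -- condition (i) for the head suffices.
    code-no113 : ∀ {p q} → at w p ≡ just d1 → at w q ≡ just d1 → at w (p + q) ≢ just d3
    code-no113 {p} {q} wp wq wpq with at-++⁻ x wpq
    ... | inj₂ (_ , k , tk) = All.lookup tail-no3 (at-∈ {i = k} tk) refl
    ... | inj₁ (p+q≤ , xpq) = case trans (sym (has113⁺ x (inHead (m≤m+n p q) wp) (inHead (m≤n+m q p) wq) xpq)) no113 of λ ()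
      where
      inHead : ∀ {i d} → i ≤ p + q → at w i ≡ just d → at x i ≡ just d
      inHead i≤ wi = trans (sym (at-++ˡ x (≤-trans i≤ p+q≤))) wi

    code-IsNumSgpGaps : IsNumSgpGaps (gaps w)
    code-IsNumSgpGaps = gaps-IsNumSgpGaps {w} code-no113

    -- Letters 1 are taken from the whole word but letters 2 from the head only, because a 2 in the
    -- tail never yields a generator (`two-minGen-head`).
    ones unsplitTwos : List ℕ
    ones = select (λ i → is (at w i) d1) (length w)
    unsplitTwos = select (λ i → is (at x i) d2 ∧ not (splits x i)) (length x)

    generators : List ℕ
    generators = (m ∷ []) ++ (map (m +_) ones ++ map (m + m +_) unsplitTwos)

    mult-minGen : MinGen (gaps w) m
    mult-minGen = (λ ()) , mult∉gaps {w} , λ (u , v , u≢0 , v≢0 , u∉ , v∉ , eq) →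
      n≮n m (≤-trans (m<m+n m (s≤s z≤n)) (subst (m + m ≤_) eq (+-mono-≤ (nongap≥mult {w} u≢0 u∉) (nongap≥mult {w} v≢0 v∉))))

    -- A sum of two nonzero nongaps is at least 2m, which exceeds m + i.
    one-minGen : ∀ {i} → at w i ≡ just d1 → MinGen (gaps w) (m + i)
    one-minGen {i} wi = (λ ()) , mid∉gaps {w} wi , λ (u , v , u≢0 , v≢0 , u∉ , v∉ , eq) →
      n≮n i (≤-trans (at-length<mult w wi) (+-cancelˡ-≤ m _ _
        (subst (m + m ≤_) eq (+-mono-≤ (nongap≥mult {w} u≢0 u∉) (nongap≥mult {w} v≢0 v∉)))))

    -- A decomposition would give p + q = i with two letters 1. Both positions are at most i, hence
    -- in the head, where i would then split.
    unsplitTwo-minGen : ∀ {i} → at x i ≡ just d2 → splits x i ≡ false → MinGen (gaps w) (m + m + i)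
    unsplitTwo-minGen {i} xi unsplit = (λ ()) , high∉gaps {w} wi (λ ()) , λ (u , v , u≢0 , v≢0 , u∉ , v∉ , eq) →
      let p , q , p+q≡i , wp , wq = decompose {w} wi (λ ()) u≢0 v≢0 u∉ v∉ eq
          inHead = λ {k} (k≤ : k ≤ p + q) (wk : at w k ≡ just d1) → trans (sym (at-++ˡ x (≤-trans k≤ (subst (_≤ length x) (sym p+q≡i) i≤)))) wk
      in case trans (sym (splits⁺ x (inHead (m≤m+n p q) wp) (inHead (m≤n+m q p) wq))) (trans (cong (splits x) p+q≡i) unsplit) of λ ()
      where
      i≤ : i ≤ length x
      i≤ = proj₂ (at-range x xi)
      wi : at w i ≡ just d2
      wi = trans (at-++ˡ x i≤) xi

    minGen-not-sum : ∀ {u v} → MinGen (gaps w) (u + v) → u ≢ 0 → v ≢ 0 → u ∉ gaps w → v ∉ gaps w → ⊥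
    minGen-not-sum (_ , _ , indec) u≢0 v≢0 u∉ v∉ = indec (_ , _ , u≢0 , v≢0 , u∉ , v∉ , refl)

    minGen-not-pair : ∀ {p q} → MinGen (gaps w) (m + m + (p + q)) → at w p ≡ just d1 → at w q ≡ just d1 → ⊥
    minGen-not-pair {p} {q} mg wp wq =
      minGen-not-sum {m + p} {m + q} (subst (MinGen (gaps w)) (rearrange m p q) mg) (λ ()) (λ ()) (mid∉gaps {w} wp) (mid∉gaps {w} wq)
      where
      rearrange : ∀ m p q → m + m + (p + q) ≡ m + p + (m + q)
      rearrange = solve-∀

    length-larges≤ : length (larges w) ≤ j
    length-larges≤ = begin
      length (larges w)      ≡⟨ length-larges w ⟩
      aT w + bT w            ≡⟨ cong₂ _+_ aT-code bT-code ⟩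
      aT x + aT t + bT x     ≤⟨ m≤m+n _ (bT x) ⟩
      aT x + aT t + bT x + bT x ≡⟨ rearrange (aT x) (aT t) (bT x) ⟩
      aT x + 2 * bT x + aT t ≡⟨ weight ⟩
      j                      ∎
      where
      open ≤-Reasoning
      rearrange : ∀ a a′ b → a + a′ + b + b ≡ a + 2 * b + a′
      rearrange = solve-∀

    -- Otherwise every pair p + q = i meets larges w, which has at most j elements.
    two-minGen-head : ∀ {i} → at w i ≡ just d2 → MinGen (gaps w) (m + m + i) → i ≤ length x
    two-minGen-head {i} wi mg = ≮⇒≥ λ x<i → n≮n i (begin-strict
      i                     <⟨ half-cover-∈ {larges w} (inLarges wi λ ()) cover ⟩
      2 * length (larges w) ≤⟨ *-monoʳ-≤ 2 length-larges≤ ⟩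
      2 * j                 ≤⟨ m≤n+m∸n (2 * j) 1 ⟩
      suc (2 * j ∸ 1)       ≡⟨ cong suc head-length ⟨
      suc (length x)        ≤⟨ x<i ⟩
      i                     ∎)
      where
      open ≤-Reasoning
      inLarges : ∀ {k d} → at w k ≡ just d → d ≢ d1 → k ∈ larges w
      inLarges wk d≢ = let 1≤k , k≤ = at-range w wk in ∈-select⁺ (λ i → large (at w i)) (length w) 1≤k k≤ (large⁺ wk d≢)
      one-or-large : ∀ {k} → 1 ≤ k → k < i → at w k ≡ just d1 ⊎ k ∈ larges w
      one-or-large 1≤k k<i with at-defined w 1≤k (≤-trans (<⇒≤ k<i) (proj₂ (at-range w wi)))
      ... | d1 , wk = inj₁ wk
      ... | d2 , wk = inj₂ (inLarges wk λ ())
      ... | d3 , wk = inj₂ (inLarges wk λ ())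
      cover : ∀ {s} → 1 ≤ s → s < i → s ∈ larges w ⊎ (i ∸ s) ∈ larges w
      cover {s} 1≤s s<i with one-or-large 1≤s s<i | one-or-large (m<n⇒0<n∸m s<i) (∸-monoʳ-< 1≤s (<⇒≤ s<i))
      ... | inj₂ p  | _       = inj₁ p
      ... | inj₁ _  | inj₂ q  = inj₂ q
      ... | inj₁ ws | inj₁ wi∸s = ⊥-elim (minGen-not-pair {s} {i ∸ s}
        (subst (λ k → MinGen (gaps w) (m + m + k)) (sym (m+[n∸m]≡n (<⇒≤ s<i))) mg) ws wi∸s)

    -- A generator is at most 2g + 1 = 2m - 1 + 2j, and 2j ≤ 3j ≤ m puts this below 3m.
    minGen≱3m : ∀ {i} → ¬ MinGen (gaps w) (m + m + m + i)
    minGen≱3m {i} mg = n≮n (m + m + m) (begin-strict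
      m + m + m                       ≤⟨ m≤m+n _ i ⟩
      m + m + m + i                   ≤⟨ half-cover {gaps w} (mingen-cover mg) ⟩
      suc (2 * length (gaps w))       ≡⟨ cong (suc ∘ (2 *_)) code-genus ⟩
      suc (2 * (length w + j))        ≡⟨ rearrange₁ (length w) j ⟩
      2 * length w + 1 + 2 * j        ≤⟨ +-monoʳ-≤ (2 * length w + 1) (≤-trans (*-monoˡ-≤ j (n≤1+n 2)) long) ⟩
      2 * length w + 1 + m            <⟨ n<1+n _ ⟩
      suc (2 * length w + 1 + m)      ≡⟨ rearrange₂ (length w) ⟩
      m + m + m                       ∎)
      where
      open ≤-Reasoning
      rearrange₁ : ∀ n j → suc (2 * (n + j)) ≡ 2 * n + 1 + 2 * j
      rearrange₁ = solve-∀
      rearrange₂ : ∀ n → suc (2 * n + 1 + suc n) ≡ suc n + suc n + suc n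
      rearrange₂ = solve-∀

    ∈-generators⁻ : ∀ {y} → y ∈ generators → MinGen (gaps w) y
    ∈-generators⁻ (here refl) = mult-minGen
    ∈-generators⁻ (there y∈) with ∈-++⁻ (map (m +_) ones) y∈
    ... | inj₁ p with ∈-map⁻ (m +_) p
    ... | i , i∈ , refl = one-minGen (is-true⁻ (proj₂ (∈-select⁻ (λ i → is (at w i) d1) (length w) i∈)))
    ∈-generators⁻ (there y∈) | inj₂ p with ∈-map⁻ (m + m +_) p
    ... | i , i∈ , refl with ∧-true⁻ (proj₂ (∈-select⁻ (λ i → is (at x i) d2 ∧ not (splits x i)) (length x) i∈))
    ... | xi , unsplit = unsplitTwo-minGen (is-true⁻ xi) (Equivalence.to T-not-≡ (Equivalence.from T-≡ unsplit))

    -- Below 2m the nonzero nongaps are m and the m + i with letter 1. From 2m on, 2m = m + m and 2m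
    -- + i = m + (m + i) for letter 1 decompose, letter 3 marks a gap, and a letter 2 must be
    -- unsplit.
    ∈-generators⁺ : ∀ {y} → MinGen (gaps w) y → y ∈ generators
    ∈-generators⁺ {y} mg with level m y
    ... | above i = ⊥-elim (minGen≱3m mg)
    ... | level₀ y<m = contradiction (≤-trans y<m (nongap≥mult {w} (proj₁ mg) (proj₁ (proj₂ mg)))) (n≮n _)
    ... | level₁ {zero} _ = here (+-identityʳ m)
    ... | level₁ {suc i} (s≤s i<) with at-defined w (s≤s z≤n) i<
    ...   | d2 , wi = contradiction (∈-gaps⁺ (mid wi λ ())) (proj₁ (proj₂ mg))
    ...   | d3 , wi = contradiction (∈-gaps⁺ (mid wi λ ())) (proj₁ (proj₂ mg))
    ...   | d1 , wi = there (∈-++⁺ˡ (∈-map⁺ (m +_) (∈-select⁺ (λ i → is (at w i) d1) (length w) (s≤s z≤n) i< (is-true⁺ wi))))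
    ∈-generators⁺ {y} mg | level₂ {zero} _ =
      ⊥-elim (minGen-not-sum {m} {m} (subst (MinGen (gaps w)) (+-identityʳ (m + m)) mg) (λ ()) (λ ()) (mult∉gaps {w}) (mult∉gaps {w}))
    ∈-generators⁺ {y} mg | level₂ {suc i} (s≤s i<) with at-defined w (s≤s z≤n) i<
    ...   | d1 , wi = ⊥-elim (minGen-not-sum {m} {m + suc i} (subst (MinGen (gaps w)) (+-assoc m m (suc i)) mg) (λ ()) (λ ()) (mult∉gaps {w}) (mid∉gaps {w} wi))
    ...   | d3 , wi = contradiction (∈-gaps⁺ (high wi)) (proj₁ (proj₂ mg))
    ...   | d2 , wi = there (∈-++⁺ʳ (map (m +_) ones) (∈-map⁺ (m + m +_)
            (∈-select⁺ (λ i → is (at x i) d2 ∧ not (splits x i)) (length x) (s≤s z≤n) i≤ (∧-true⁺ (is-true⁺ xi) unsplit))))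
      where
      i≤ : suc i ≤ length x
      i≤ = two-minGen-head wi mg
      xi : at x (suc i) ≡ just d2
      xi = trans (sym (at-++ˡ x i≤)) wi
      unsplit : not (splits x (suc i)) ≡ true
      unsplit with splits x (suc i) in eq
      ... | false = refl
      ... | true with splits⁻ x eq
      ... | p , q , p+q≡i , xp , xq = ⊥-elim (minGen-not-pair {p} {q}
        (subst (λ k → MinGen (gaps w) (m + m + k)) (sym p+q≡i) mg)
        (trans (at-++ˡ x (proj₂ (at-range x xp))) xp) (trans (at-++ˡ x (proj₂ (at-range x xq))) xq))

    generators-sorted : AllPairs _<_ generators
    generators-sorted = sorted-three-blocks ([] ∷ [])
      (select-sorted (λ i → is (at w i) d1) (length w)) (select-sorted (λ i → is (at x i) d2 ∧ not (splits x i)) (length x))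
      (≤-refl ∷ [])
      (All.map (λ (1≤i , i≤) → 1≤i , m≤n⇒m≤1+n i≤) (select-bounds (λ i → is (at w i) d1) (length w)))
      (All.map proj₁ (select-bounds (λ i → is (at x i) d2 ∧ not (splits x i)) (length x)))

    code-EmbDim : EmbDim (gaps w) (length generators)
    code-EmbDim = generators , AllPairs.map <⇒≢ generators-sorted , (λ _ → mk⇔ ∈-generators⁻ ∈-generators⁺) , refl

    -- With g = `length w + j` this says e = g + 1 + a + b - c - 2j, kept additive to avoid
    -- truncated subtraction.
    length-generators : length generators + (2 * j + cT x) ≡ length w + j + 1 + (aT x + bT x)
    length-generators = begin
      length generators + (2 * j + cT x)
        ≡⟨ cong (λ k → suc k + (2 * j + cT x)) (trans (length-++ (map (m +_) ones)) (cong₂ _+_ (length-map _ ones) (length-map _ unsplitTwos))) ⟩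
      suc (length ones + length unsplitTwos) + (2 * j + cT x)
        ≡⟨ rearrange₁ (length ones) (length unsplitTwos) j (cT x) ⟩
      1 + length ones + (cT x + length unsplitTwos) + j + j
        ≡⟨ cong₂ (λ o u → 1 + o + u + j + j) (length-select-at (λ m → is m d1) w) (cT-unsplit x) ⟩
      1 + count (_==D d1) w + aT x + j + j
        -- Only one of the two copies of j is expanded: it supplies the 2s of the tail and one set
        -- of 3s, which complete the letter count of the whole word.
        ≡⟨ cong (λ k → 1 + count (_==D d1) w + aT x + k + j) weight ⟨
      1 + count (_==D d1) w + aT x + (aT x + 2 * bT x + aT t) + j
        ≡⟨ rearrange₂ (count (_==D d1) w) (aT x) (bT x) (aT t) j ⟩
      (count (_==D d1) w + (aT x + aT t + bT x)) + j + 1 + (aT x + bT x)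
        ≡⟨ cong (λ k → (count (_==D d1) w + k) + j + 1 + (aT x + bT x)) (cong₂ _+_ aT-code bT-code) ⟨
      (count (_==D d1) w + (aT w + bT w)) + j + 1 + (aT x + bT x)
        ≡⟨ cong (λ k → k + j + 1 + (aT x + bT x)) (count-partition w) ⟩
      length w + j + 1 + (aT x + bT x) ∎
      where
      open ≡-Reasoning
      rearrange₁ : ∀ o u j c → suc (o + u) + (2 * j + c) ≡ 1 + o + (c + u) + j + j
      rearrange₁ = solve-∀
      rearrange₂ : ∀ o a b a′ j → 1 + o + a + (a + 2 * b + a′) + j ≡ (o + (a + a′ + b)) + j + 1 + (a + b)
      rearrange₂ = solve-∀

  -- Kunz words from semigroups

  -- If m is a nongap and 2m + i a gap, then m + i is a gap too. Testing from the top thus reads off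
  -- the number of gaps in the class of i, given 1 ≤ i < m and no gaps from 3m on.
  classify : List ℕ → ℕ → ℕ → D
  classify G m i with m + m + i ∈? G | m + i ∈? G
  ... | yes _ | _     = d3
  ... | no _  | yes _ = d2
  ... | no _  | no _  = d1

  decode : ℕ → List ℕ → List D
  decode n G = applyUpTo (λ i → classify G (suc n) (suc i)) n

  at-decode : ∀ {n G i} → 1 ≤ i → i ≤ n → at (decode n G) i ≡ just (classify G (suc n) i)
  at-decode (s≤s z≤n) i≤n = at-applyUpTo _ i≤n

  length-decode : ∀ n G → length (decode n G) ≡ n
  length-decode n G = length-applyUpTo (λ i → classify G (suc n) (suc i)) n

  decode-gaps : ∀ w → decode (length w) (gaps w) ≡ w
  decode-gaps w = sym (at-ext (sym (length-decode _ (gaps w))) λ {i} wi →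
    let 1≤i , i≤ = at-range w wi in trans (at-decode 1≤i i≤) (cong just (correct wi)))
    where
    correct : ∀ {i d} → at w i ≡ just d → classify (gaps w) (mult w) i ≡ d
    correct {i} wi with mult w + mult w + i ∈? gaps w | mult w + i ∈? gaps w
    correct wi | yes p | _ = at-functional w (gap-high⁻ p) wi
    correct {d = d1} wi | no _ | yes q = contradiction q (mid∉gaps {w} wi)
    correct {d = d2} wi | no _ | yes q = refl
    correct {d = d3} wi | no p | yes _ = contradiction (∈-gaps⁺ (high wi)) p
    correct {d = d1} wi | no _ | no _ = refl
    correct {d = d2} wi | no _ | no q = contradiction (∈-gaps⁺ (mid wi λ ())) q
    correct {d = d3} wi | no _ | no q = contradiction (∈-gaps⁺ (mid wi λ ())) q

  -- `decode` inverts `gaps` once the length is known, and the gap set determines the length because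
  -- the multiplicity is the least nonzero nongap.
  gaps-injective : ∀ {u v} → gaps u ≡ gaps v → u ≡ v
  gaps-injective {u} {v} eq = begin
    u                          ≡⟨ decode-gaps u ⟨
    decode (length u) (gaps u) ≡⟨ cong₂ decode (≤-antisym (shorter eq) (shorter (sym eq))) eq ⟩
    decode (length v) (gaps v) ≡⟨ decode-gaps v ⟩
    v                          ∎
    where
    open ≡-Reasoning
    shorter : ∀ {u v} → gaps u ≡ gaps v → length u ≤ length v
    shorter {u} {v} eq = ≮⇒≥ λ v<u → mult∉gaps {v} (subst (mult v ∈_) eq (gap-low (s≤s z≤n) (s≤s v<u)))

  gaps-decode : ∀ {n G} → IsNumSgpGaps G → (∀ {i} → 1 ≤ i → i ≤ n → i ∈ G) → suc n ∉ G →
    (∀ i → suc n + suc n + suc n + i ∉ G) → gaps (decode n G) ≡ G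
  gaps-decode {n} {G} (sorted , 0∉ , closed) below m∉ bounded =
    sorted-ext (gaps-sorted w) (Linked⇒AllPairs <-trans sorted) (⊆G ∘ ∈-gaps⁻) (λ {y} → ⊇G (level (suc n) y))
    where
    w : List D
    w = decode n G
    lw : length w ≡ n
    lw = length-decode n G
    classified : ∀ {i d} → at w i ≡ just d → classify G (suc n) i ≡ d
    classified {i} wi = let 1≤i , i≤ = at-range w wi in
      just-injective (trans (sym (at-decode 1≤i (subst (i ≤_) lw i≤))) wi)
    middle : ∀ i → classify G (suc n) i ≢ d1 → suc n + i ∈ G
    middle i c≢ with suc n + suc n + i ∈? G | suc n + i ∈? G
    ... | _     | yes q = q
    ... | no _  | no _  = contradiction refl c≢
    -- A nongap m + i would make 2m + i = m + (m + i) a nongap.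
    ... | yes p | no q  = contradiction (subst (_∈ G) (+-assoc (suc n) (suc n) i) p) (closed (suc n) (suc n + i) m∉ q)
    top : ∀ i → classify G (suc n) i ≡ d3 → suc n + suc n + i ∈ G
    top i c≡ with suc n + suc n + i ∈? G | suc n + i ∈? G
    top i c≡ | yes p | _ = p
    top i () | no _ | yes _
    top i () | no _ | no _
    ⊆G : ∀ {y} → IsGap w y → y ∈ G
    ⊆G {y} (low 1≤y y≤) = below 1≤y (subst (y ≤_) lw y≤)
    ⊆G (mid {i} wi d≢) = subst (λ k → suc k + i ∈ G) (sym lw) (middle i (d≢ ∘ trans (sym (classified wi))))
    ⊆G (high {i} wi) = subst (λ k → suc k + suc k + i ∈ G) (sym lw) (top i (classified wi))
    not-one : ∀ i → suc n + i ∈ G → classify G (suc n) i ≢ d1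
    not-one i q eq with suc n + suc n + i ∈? G | suc n + i ∈? G
    not-one i q () | yes _ | _
    not-one i q () | no _ | yes _
    not-one i q eq | no _ | no q′ = q′ q
    three : ∀ i → suc n + suc n + i ∈ G → classify G (suc n) i ≡ d3
    three i p with suc n + suc n + i ∈? G
    ... | yes _ = refl
    ... | no p′ = contradiction p p′
    ⊇G : ∀ {y} → Level (suc n) y → y ∈ G → y ∈ gaps w
    ⊇G (level₀ {zero} _) y∈ = contradiction y∈ 0∉
    ⊇G (level₀ {suc i} (s≤s i<)) y∈ = ∈-gaps⁺ (low (s≤s z≤n) (subst (suc i ≤_) (sym lw) i<))
    ⊇G (level₁ {zero} _) y∈ = contradiction (subst (_∈ G) (+-identityʳ (suc n)) y∈) m∉
    ⊇G (level₁ {suc i} (s≤s i<)) y∈ = subst (λ k → suc k + suc i ∈ gaps w) lw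
      (∈-gaps⁺ (mid (at-decode (s≤s z≤n) i<) (not-one (suc i) y∈)))
    ⊇G (level₂ {zero} _) y∈ = contradiction (subst (_∈ G) (+-identityʳ (suc n + suc n)) y∈) (closed (suc n) (suc n) m∉ m∉)
    ⊇G (level₂ {suc i} (s≤s i<)) y∈ = subst (λ k → suc k + suc k + suc i ∈ gaps w) lw
      (∈-gaps⁺ (high (trans (at-decode (s≤s z≤n) i<) (cong just (three (suc i) y∈)))))
    ⊇G (above i) y∈ = contradiction y∈ (bounded i)

  -- If 1, ..., n all lie in G then n is at most the length of G, so an upward search with one more
  -- unit of fuel than that length must stop at the least positive nongap.
  multiplicity : ∀ G → ∃ λ n → (∀ {i} → 1 ≤ i → i ≤ n → i ∈ G) × suc n ∉ G × n ≤ length G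
  multiplicity G = search (suc (length G)) 0 (λ { (s≤s _) () }) (+-identityʳ _)
    where
    bound : ∀ {n} → (∀ {i} → 1 ≤ i → i ≤ n → i ∈ G) → n ≤ length G
    bound {n} below = subst (_≤ length G) (length-applyUpTo suc n)
      (unique-⊆-length (AllPairs.map <⇒≢ (range-sorted n)) λ i∈ → let 1≤i , i≤ = ∈-range⁻ i∈ in below 1≤i i≤)
    search : ∀ fuel n → (∀ {i} → 1 ≤ i → i ≤ n → i ∈ G) → fuel + n ≡ suc (length G) →
      ∃ λ n → (∀ {i} → 1 ≤ i → i ≤ n → i ∈ G) × suc n ∉ G × n ≤ length G
    search zero n below refl = contradiction (bound below) (n≮n _)
    search (suc fuel) n below eq with suc n ∈? G
    ... | no m∉ = n , below , m∉ , bound below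
    ... | yes m∈ = search fuel (suc n) below′ (trans (+-suc fuel n) eq)
      where
      below′ : ∀ {i} → 1 ≤ i → i ≤ suc n → i ∈ G
      below′ 1≤i i≤ with m≤n⇒m<n∨m≡n i≤
      ... | inj₁ (s≤s i≤n) = below 1≤i i≤n
      ... | inj₂ refl = m∈

  -- Injectivity is asked on the list only, since reduction modulo m is injective just on the
  -- minimal generators.
  unique-map : {f : A → B} {xs : List A} → (∀ {x y} → x ∈ xs → y ∈ xs → f x ≡ f y → x ≡ y) →
    Unique xs → Unique (map f xs)
  unique-map _ [] = []
  unique-map {f = f} inj (x∉ ∷ uxs) =
    Allₚ.map⁺ (All.tabulate λ y∈ fx≡fy → All.lookup x∉ y∈ (inj (here refl) (there y∈) fx≡fy))
    ∷ unique-map (λ x∈ y∈ → inj (there x∈) (there y∈)) uxs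

  -- Distinct minimal generators are incongruent modulo any nonzero element of the semigroup.
  EmbDim≤element : ∀ {G n e} → IsNumSgpGaps G → suc n ∉ G → EmbDim G e → e ≤ suc n
  EmbDim≤element {G} {n} (_ , 0∉ , closed) m∉ (xs , uxs , xs⇔ , refl) = begin
    length xs                     ≡⟨ length-map (_% suc n) xs ⟨
    length (map (_% suc n) xs)    ≤⟨ unique-⊆-length (unique-map congruent⇒equal uxs) residue ⟩
    length (upTo (suc n))         ≡⟨ length-applyUpTo id (suc n) ⟩
    suc n                         ∎
    where
    open ≤-Reasoning
    residue : ∀ {r} → r ∈ map (_% suc n) xs → r ∈ upTo (suc n)
    residue r∈ with ∈-map⁻ (_% suc n) r∈
    ... | x , _ , refl = ∈-upTo⁺ (m%n<n x (suc n))
    multiple∉ : ∀ k → k * suc n ∉ G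
    multiple∉ zero = 0∉
    multiple∉ (suc k) = closed (suc n) (k * suc n) m∉ (multiple∉ k)
    not< : ∀ {x y} → MinGen G x → MinGen G y → x % suc n ≡ y % suc n → ¬ x < y
    not< {x} {y} (x≢0 , x∉ , _) (_ , _ , indec) eq x<y with m≤n⇒∃[o]m+o≡n quotients
      where
      quotients : x / suc n < y / suc n
      quotients = *-cancelʳ-< (suc n) _ _ (+-cancelˡ-< (x % suc n) _ _ (subst₂ _<_ (m≡m%n+[m/n]*n x (suc n))
        (trans (m≡m%n+[m/n]*n y (suc n)) (cong (_+ y / suc n * suc n) (sym eq))) x<y))
    -- The residues agree and the quotients differ by k + 1, so y is x plus the nonzero multiple (k
    -- + 1)m, which is a nongap.
    ... | k , quot = indec (x , suc k * suc n , x≢0 , (λ ()) , x∉ , multiple∉ (suc k) , (begin-equality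
      x + suc k * suc n                               ≡⟨ cong (_+ suc k * suc n) (m≡m%n+[m/n]*n x (suc n)) ⟩
      x % suc n + x / suc n * suc n + suc k * suc n   ≡⟨ rearrange (x % suc n) (x / suc n) k (suc n) ⟩
      x % suc n + (suc (x / suc n) + k) * suc n       ≡⟨ cong₂ (λ r q → r + q * suc n) eq quot ⟩
      y % suc n + y / suc n * suc n                   ≡⟨ m≡m%n+[m/n]*n y (suc n) ⟨
      y                                               ∎))
      where
      rearrange : ∀ r q k m → r + q * m + suc k * m ≡ r + (suc q + k) * m
      rearrange = solve-∀
    congruent⇒equal : ∀ {x y} → x ∈ xs → y ∈ xs → x % suc n ≡ y % suc n → x ≡ y
    congruent⇒equal {x} {y} x∈ y∈ eq =
      ≤-antisym (≮⇒≥ (not< (mg y∈) (mg x∈) (sym eq))) (≮⇒≥ (not< (mg x∈) (mg y∈) eq))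
      where
      mg : ∀ {z} → z ∈ xs → MinGen G z
      mg {z} = Equivalence.to (xs⇔ z)

  ∈⇒at : ∀ {d t} → d ∈ t → ∃ λ i → at t (suc i) ≡ just d
  ∈⇒at (here refl) = 0 , refl
  ∈⇒at (there d∈) with ∈⇒at d∈
  ... | i , eq = suc i , eq

  -- L stands for l + 1.
  record Word (L g : ℕ) (w : List D) : Set where
    field
      {j}      : ℕ
      {x t}    : List D
      split    : w ≡ x ++ t
      j≤L      : j ≤ L
      code     : Code j x t
      size     : length w + j ≡ g
      balance  : aT x + bT x + L ≡ 2 * j + cT x

  -- `balance` is the condition under which the count in `length-generators` becomes g + 1 - L; the
  -- common term a + b cancels.
  Word-EmbDim : ∀ {L g w} → Word L g w → ∃ λ e → EmbDim (gaps w) e × e + L ≡ suc g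
  Word-EmbDim {L} {g} record { j = j ; x = x ; t = t ; split = refl ; code = code ; size = size ; balance = balance } =
    e , code-EmbDim code , +-cancelʳ-≡ (aT x + bT x) (e + L) (suc g) (begin
      e + L + (aT x + bT x)                       ≡⟨ rearrange e L (aT x + bT x) ⟩
      e + (aT x + bT x + L)                       ≡⟨ cong (e +_) balance ⟩
      e + (2 * j + cT x)                          ≡⟨ length-generators code ⟩
      length (x ++ t) + j + 1 + (aT x + bT x)     ≡⟨ cong (λ k → k + 1 + (aT x + bT x)) size ⟩
      g + 1 + (aT x + bT x)                       ≡⟨ cong (_+ (aT x + bT x)) (+-comm g 1) ⟩
      suc g + (aT x + bT x)                       ∎)
    where
    open ≡-Reasoning
    e : ℕ
    e = length (generators code)
    rearrange : ∀ e L k → e + L + k ≡ e + (k + L)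
    rearrange = solve-∀

  Word-gaps : ∀ {L g w} → Word L g w →
    IsNumSgpGaps (gaps w) × genus (gaps w) ≡ g × ∃ λ e → EmbDim (gaps w) e × e + L ≡ suc g
  Word-gaps word@record { split = refl ; code = code ; size = size } =
    code-IsNumSgpGaps code , trans (code-genus code) size , Word-EmbDim word

  -- The code of a given semigroup

  module Converse {L g G e n} (4L≤ : 4 * L ≤ suc g) (sgp : IsNumSgpGaps G) (genus≡ : genus G ≡ g)
                  (emb : EmbDim G e) (e+L≡ : e + L ≡ suc g)
                  (below : ∀ {i} → 1 ≤ i → i ≤ n → i ∈ G) (m∉ : suc n ∉ G) (n≤ : n ≤ length G) where

    private
      j h : ℕ
      j = g ∸ n
      h = 2 * j ∸ 1
      w x t : List D
      w = decode n G
      x = take h w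
      t = drop h w

      n+j≡g : n + j ≡ g
      n+j≡g = m+[n∸m]≡n (subst (n ≤_) genus≡ n≤)

      j≤L : j ≤ L
      j≤L = +-cancelˡ-≤ (suc n) _ _ (begin
        suc n + j ≡⟨ cong suc n+j≡g ⟩
        suc g     ≡⟨ e+L≡ ⟨
        e + L     ≤⟨ +-monoˡ-≤ L (EmbDim≤element sgp m∉ emb) ⟩
        suc n + L ∎)
        where open ≤-Reasoning

      -- Since g + 1 = m + j, the chain 4j ≤ 4L ≤ g + 1 leaves 3j ≤ m after cancelling j.
      3j≤ : 3 * j ≤ suc n
      3j≤ = +-cancelˡ-≤ j _ _ (begin
        4 * j       ≤⟨ *-monoʳ-≤ 4 j≤L ⟩
        4 * L       ≤⟨ 4L≤ ⟩
        suc g       ≡⟨ cong suc n+j≡g ⟨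
        suc (n + j) ≡⟨ +-comm (suc n) j ⟩
        j + suc n   ∎)
        where open ≤-Reasoning

      frobenius : ∀ {y} → y ∈ G → suc y ≤ 2 * n + 2 * j
      frobenius {y} y∈ = begin
        suc y         ≤⟨ half-cover-∈ y∈ (gap-cover sgp y∈) ⟩
        2 * length G  ≡⟨ cong (2 *_) (trans genus≡ (sym n+j≡g)) ⟩
        2 * (n + j)   ≡⟨ *-distribˡ-+ 2 n j ⟩
        2 * n + 2 * j ∎
        where open ≤-Reasoning

      bounded : ∀ i → suc n + suc n + suc n + i ∉ G
      bounded i y∈ = n≮n _ (begin-strict
        2 * n + 2 * j                 ≤⟨ +-monoʳ-≤ (2 * n) (≤-trans (*-monoˡ-≤ j (n≤1+n 2)) 3j≤) ⟩
        2 * n + suc n                 ≤⟨ m≤m+n _ (2 + i) ⟩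
        2 * n + suc n + (2 + i)       ≡⟨ rearrange n i ⟩
        suc n + suc n + suc n + i     <⟨ frobenius y∈ ⟩
        2 * n + 2 * j                 ∎)
        where
        open ≤-Reasoning
        rearrange : ∀ n i → 2 * n + suc n + (2 + i) ≡ suc n + suc n + suc n + i
        rearrange = solve-∀

      x++t≡w : x ++ t ≡ w
      x++t≡w = take++drop≡id h w

      length-w : length (x ++ t) ≡ n
      length-w = trans (cong length x++t≡w) (length-decode n G)

      length-x : length x ≡ h
      length-x = trans (length-take h w) (m≤n⇒m⊓n≡m (begin
        2 * j ∸ 1  ≤⟨ ∸-monoˡ-≤ 1 (*-monoˡ-≤ j (n≤1+n 2)) ⟩
        3 * j ∸ 1  ≤⟨ ∸-monoˡ-≤ 1 3j≤ ⟩
        n          ≡⟨ length-decode n G ⟨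
        length w   ∎))
        where open ≤-Reasoning

    gaps-word : gaps (x ++ t) ≡ G
    gaps-word = trans (cong gaps x++t≡w) (gaps-decode sgp below m∉ bounded)

    private
      ∈G⁺ : ∀ {y} → y ∈ gaps (x ++ t) → y ∈ G
      ∈G⁺ {y} = subst (y ∈_) gaps-word

      -- A letter 3 beyond the head, at a position of at least 2j, would be a gap of at least 2m +
      -- 2j = 2g + 2, above the bound of `frobenius`.
      t-no3 : All (_≢ d3) t
      t-no3 = All.tabulate λ { d∈ refl → absurd (∈⇒at d∈) }
        where
        absurd : ¬ ∃ λ i → at t (suc i) ≡ just d3
        absurd (i , ti) = n≮n _ (begin-strict
          2 * n + 2 * j                       ≤⟨ +-monoʳ-≤ (2 * n) (m≤n+m∸n (2 * j) 1) ⟩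
          2 * n + suc h                       ≤⟨ m≤m+n _ (2 + i) ⟩
          2 * n + suc h + (2 + i)             ≡⟨ rearrange n h i ⟩
          suc n + suc n + (h + suc i)         <⟨ frobenius gap ⟩
          2 * n + 2 * j                       ∎)
          where
          open ≤-Reasoning
          rearrange : ∀ n h i → 2 * n + suc h + (2 + i) ≡ suc n + suc n + (h + suc i)
          rearrange = solve-∀
          gap : suc n + suc n + (h + suc i) ∈ G
          gap = subst₂ (λ k h → suc k + suc k + (h + suc i) ∈ G) length-w length-x
            (∈G⁺ (∈-gaps⁺ {x ++ t} (high (trans (at-++ʳ x i) ti))))

      -- A triple (1,1,3) would present the gap 2m + p + q as the sum of the nongaps m + p and m +
      -- q.
      no113 : has113 x ≡ false
      no113 with has113 x in eq
      ... | false = refl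
      ... | true with has113⁻ x eq
      ... | p , q , xp , xq , xpq = contradiction
        (subst (_∈ G) (rearrange (mult (x ++ t)) p q) (∈G⁺ (∈-gaps⁺ {x ++ t} (high (inWord xpq)))))
        (proj₂ (proj₂ sgp) _ _ (one xp) (one xq))
        where
        rearrange : ∀ m p q → m + m + (p + q) ≡ (m + p) + (m + q)
        rearrange = solve-∀
        inWord : ∀ {i d} → at x i ≡ just d → at (x ++ t) i ≡ just d
        inWord xi = trans (at-++ˡ x (proj₂ (at-range x xi))) xi
        one : ∀ {i} → at x i ≡ just d1 → mult (x ++ t) + i ∉ G
        one {i} xi = mid∉gaps {x ++ t} (inWord xi) ∘ subst (mult (x ++ t) + i ∈_) (sym gaps-word)

      -- The genus is counted twice: as n + j, and letter by letter through `length-gaps`, where the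
      -- tail contributes no 3s.
      weight : aT x + 2 * bT x + aT t ≡ j
      weight = +-cancelˡ-≡ n _ _ (begin
        n + (aT x + 2 * bT x + aT t)
          ≡⟨ rearrange n (aT x) (bT x) (aT t) ⟩
        n + (aT x + aT t + 2 * (bT x + 0))
          ≡⟨ cong (λ b → n + (aT x + aT t + 2 * (bT x + b))) (bT≡0 t-no3) ⟨
        n + (aT x + aT t + 2 * (bT x + bT t))
          ≡⟨ cong₂ _+_ length-w (cong₂ (λ a b → a + 2 * b) (count-++ _ x t) (count-++ _ x t)) ⟨
        length (x ++ t) + (aT (x ++ t) + 2 * bT (x ++ t))
          ≡⟨ length-gaps (x ++ t) ⟨
        length (gaps (x ++ t))
          ≡⟨ cong length gaps-word ⟩
        length G
          ≡⟨ trans genus≡ (sym n+j≡g) ⟩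
        n + j ∎)
        where
        open ≡-Reasoning
        rearrange : ∀ n a b a′ → n + (a + 2 * b + a′) ≡ n + (a + a′ + 2 * (b + 0))
        rearrange = solve-∀

      code : Code j x t
      code = record
        { head-length = length-x
        ; no113       = no113
        ; tail-no3    = t-no3
        ; weight      = weight
        ; long        = subst (3 * j ≤_) (cong suc (sym length-w)) 3j≤
        }

      size : length (x ++ t) + j ≡ g
      size = trans (cong (_+ j) length-w) n+j≡g

      balance : aT x + bT x + L ≡ 2 * j + cT x
      balance = +-cancelˡ-≡ e _ _ (begin
        e + (aT x + bT x + L)                   ≡⟨ rearrange e L (aT x + bT x) ⟩
        e + L + (aT x + bT x)                   ≡⟨ cong (_+ (aT x + bT x)) e+L≡ ⟩
        suc g + (aT x + bT x)                   ≡⟨ cong (_+ (aT x + bT x)) (+-comm 1 g) ⟩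
        g + 1 + (aT x + bT x)                   ≡⟨ cong (λ k → k + 1 + (aT x + bT x)) size ⟨
        length (x ++ t) + j + 1 + (aT x + bT x) ≡⟨ length-generators code ⟨
        length (generators code) + (2 * j + cT x)
          -- The explicit list of generators and the one witnessing e enumerate the same set, so
          -- their lengths agree.
          ≡⟨ cong (_+ (2 * j + cT x)) (HasCard-unique (code-EmbDim code) (subst (λ H → EmbDim H e) (sym gaps-word) emb)) ⟩
        e + (2 * j + cT x)                      ∎)
        where
        open ≡-Reasoning
        rearrange : ∀ e L k → e + (k + L) ≡ e + L + k
        rearrange = solve-∀

    word : Word L g (x ++ t)
    word = record { split = refl ; j≤L = j≤L ; code = code ; size = size ; balance = balance }

  -- Enumeration

  -- The words of length n over {1,2} with r letters 2, split by first letter so that counting them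
  -- is Pascal's rule.
  tails : ℕ → ℕ → List (List D)
  tails zero    zero    = [] ∷ []
  tails zero    (suc r) = []
  tails (suc n) zero    = map (d1 ∷_) (tails n zero)
  tails (suc n) (suc r) = map (d1 ∷_) (tails n (suc r)) ++ map (d2 ∷_) (tails n r)

  length-tails : ∀ n r → length (tails n r) ≡ n C r
  length-tails zero    zero    = refl
  length-tails zero    (suc r) = refl
  length-tails (suc n) zero    = trans (length-map (d1 ∷_) (tails n zero)) (length-tails n zero)
  length-tails (suc n) (suc r) = begin
    length (map (d1 ∷_) (tails n (suc r)) ++ map (d2 ∷_) (tails n r))
      ≡⟨ length-++ (map (d1 ∷_) (tails n (suc r))) ⟩
    length (map (d1 ∷_) (tails n (suc r))) + length (map (d2 ∷_) (tails n r))
      ≡⟨ cong₂ _+_ (trans (length-map _ (tails n (suc r))) (length-tails n (suc r))) (trans (length-map _ (tails n r)) (length-tails n r)) ⟩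
    n C suc r + n C r
      ≡⟨ +-comm (n C suc r) (n C r) ⟩
    n C r + n C suc r
      ≡⟨ nCk+nC[k+1]≡[n+1]C[k+1] n r ⟩
    suc n C suc r ∎
    where open ≡-Reasoning

  tails-unique : ∀ n r → Unique (tails n r)
  tails-unique zero    zero    = [] ∷ []
  tails-unique zero    (suc r) = []
  tails-unique (suc n) zero    = Uniqueₚ.map⁺ ∷-injectiveʳ (tails-unique n zero)
  tails-unique (suc n) (suc r) = Uniqueₚ.++⁺ (Uniqueₚ.map⁺ ∷-injectiveʳ (tails-unique n (suc r)))
    (Uniqueₚ.map⁺ ∷-injectiveʳ (tails-unique n r)) disjoint
    where
    disjoint : ∀ {t} → ¬ (t ∈ map (d1 ∷_) (tails n (suc r)) × t ∈ map (d2 ∷_) (tails n r))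
    disjoint (p , q) with ∈-map⁻ (d1 ∷_) p | ∈-map⁻ (d2 ∷_) q
    ... | _ , _ , refl | _ , _ , ()

  ∈-tails⁺ : ∀ {t} → All (_≢ d3) t → t ∈ tails (length t) (aT t)
  ∈-tails⁺ [] = here refl
  ∈-tails⁺ {d1 ∷ t} (_ ∷ no3) with aT t | ∈-tails⁺ no3
  ... | zero  | t∈ = ∈-map⁺ (d1 ∷_) t∈
  ... | suc r | t∈ = ∈-++⁺ˡ (∈-map⁺ (d1 ∷_) t∈)
  ∈-tails⁺ {d2 ∷ t} (_ ∷ no3) = ∈-++⁺ʳ (map (d1 ∷_) (tails (length t) (suc (aT t)))) (∈-map⁺ (d2 ∷_) (∈-tails⁺ no3))
  ∈-tails⁺ {d3 ∷ t} (d≢ ∷ _) = contradiction refl d≢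

  ∈-tails⁻ : ∀ n r {t} → t ∈ tails n r → length t ≡ n × aT t ≡ r × All (_≢ d3) t
  ∈-tails⁻ zero zero (here refl) = refl , refl , []
  ∈-tails⁻ (suc n) zero t∈ with ∈-map⁻ (d1 ∷_) t∈
  ... | t , t∈′ , refl with ∈-tails⁻ n zero t∈′
  ... | len , a , no3 = cong suc len , a , (λ ()) ∷ no3
  ∈-tails⁻ (suc n) (suc r) t∈ with ∈-++⁻ (map (d1 ∷_) (tails n (suc r))) t∈
  ∈-tails⁻ (suc n) (suc r) t∈ | inj₁ p with ∈-map⁻ (d1 ∷_) p
  ... | t , t∈′ , refl with ∈-tails⁻ n (suc r) t∈′
  ... | len , a , no3 = cong suc len , a , (λ ()) ∷ no3
  ∈-tails⁻ (suc n) (suc r) t∈ | inj₂ p with ∈-map⁻ (d2 ∷_) p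
  ... | t , t∈′ , refl with ∈-tails⁻ n r t∈′
  ... | len , a , no3 = cong suc len , cong suc a , (λ ()) ∷ no3

  prepends : List D → List (List D)
  prepends x = (d1 ∷ x) ∷ (d2 ∷ x) ∷ (d3 ∷ x) ∷ []

  ∈-prepends⁺ : ∀ {d x} → (d ∷ x) ∈ prepends x
  ∈-prepends⁺ {d1} = here refl
  ∈-prepends⁺ {d2} = there (here refl)
  ∈-prepends⁺ {d3} = there (there (here refl))

  ∈-prepends⁻ : ∀ {x y} → y ∈ prepends x → ∃ λ d → y ≡ d ∷ x
  ∈-prepends⁻ (here eq) = d1 , eq
  ∈-prepends⁻ (there (here eq)) = d2 , eq
  ∈-prepends⁻ (there (there (here eq))) = d3 , eq

  allTuples-unique : ∀ n → Unique (allTuples n)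
  allTuples-unique zero = [] ∷ []
  allTuples-unique (suc n) = concatMap-unique (drop 1) (allTuples-unique n)
    (λ _ → ((λ ()) ∷ (λ ()) ∷ []) ∷ ((λ ()) ∷ []) ∷ [] ∷ [])
    (λ _ y∈ → case ∈-prepends⁻ y∈ of λ { (_ , refl) → refl })

  ∈-allTuples⁺ : ∀ x → x ∈ allTuples (length x)
  ∈-allTuples⁺ [] = here refl
  ∈-allTuples⁺ (d ∷ x) = ∈-concatMap⁺′ {f = prepends} (∈-allTuples⁺ x) ∈-prepends⁺

  ∈-allTuples⁻ : ∀ n {x} → x ∈ allTuples n → length x ≡ n
  ∈-allTuples⁻ zero (here refl) = refl
  ∈-allTuples⁻ (suc n) x∈ with ∈-concatMap⁻′ prepends (allTuples n) x∈
  ... | x , x∈′ , y∈ with ∈-prepends⁻ y∈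
  ... | _ , refl = cong suc (∈-allTuples⁻ n x∈′)

  heads : ℕ → ℕ → List (List D)
  heads L j = filter (λ x → aT x + bT x + L ≟ 2 * j + cT x) (Ylist j)

  -- A word has m - 1 = g - j letters, of which the head takes 2j - 1, or none when j = 0. The
  -- weight left over by the head is the number of 2s in the tail.
  codes : ℕ → ℕ → ℕ → List (List D)
  codes L g j = concatMap (λ x → map (x ++_) (tails (g ∸ j ∸ (2 * j ∸ 1)) (j ∸ (aT x + 2 * bT x)))) (heads L j)

  words : ℕ → ℕ → List (List D)
  words L g = concatMap (codes L g) (applyUpTo id (suc L))

  ∈-heads⁺ : ∀ {L j x} → length x ≡ 2 * j ∸ 1 → has113 x ≡ false → aT x + 2 * bT x ≤ j →
    aT x + bT x + L ≡ 2 * j + cT x → x ∈ heads L j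
  ∈-heads⁺ {L} {j} {x} len no113 le bal = ∈-filter⁺ (λ x → aT x + bT x + L ≟ 2 * j + cT x)
    (∈-filter⁺ (λ x → Boolₚ._≟_ (not (has113 x) ∧ ⌊ aT x + 2 * bT x ≤? j ⌋) true)
      (subst (λ n → x ∈ allTuples n) len (∈-allTuples⁺ x))
      (∧-true⁺ (cong not no113) (Equivalence.to T-≡ (fromWitness {a? = aT x + 2 * bT x ≤? j} le))))
    bal

  ∈-heads⁻ : ∀ {L j x} → x ∈ heads L j →
    length x ≡ 2 * j ∸ 1 × has113 x ≡ false × aT x + 2 * bT x ≤ j × aT x + bT x + L ≡ 2 * j + cT x
  ∈-heads⁻ {L} {j} {x} x∈ with ∈-filter⁻ (λ x → aT x + bT x + L ≟ 2 * j + cT x) {xs = Ylist j} x∈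
  ... | x∈Y , bal with ∈-filter⁻ (λ x → Boolₚ._≟_ (not (has113 x) ∧ ⌊ aT x + 2 * bT x ≤? j ⌋) true) {xs = allTuples (2 * j ∸ 1)} x∈Y
  ... | x∈all , ok with ∧-true⁻ {not (has113 x)} ok
  ... | no113 , le = ∈-allTuples⁻ _ x∈all , Equivalence.to T-not-≡ (Equivalence.from T-≡ no113)
                   , toWitness {a? = aT x + 2 * bT x ≤? j} (Equivalence.from T-≡ le) , bal

  -- Correctness and length of the enumeration

  module Enumeration {L g : ℕ} (4L≤ : 4 * L ≤ suc g) where

    private
      tailLength : ℕ → ℕ
      tailLength j = g ∸ j ∸ (2 * j ∸ 1)

    -- The subtractions in `tailLength` do not truncate: for positive j, 3j ≤ 4L ≤ g + 1 gives j +
    -- (2j - 1) ≤ g.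
    size-split : ∀ {j} → j ≤ L → j + ((2 * j ∸ 1) + tailLength j) ≡ g
    size-split {j} j≤L = begin
      j + ((2 * j ∸ 1) + (g ∸ j ∸ (2 * j ∸ 1))) ≡⟨ cong (j +_) (m+[n∸m]≡n (m+n≤o⇒n≤o∸m {j} (head-fits j j≤L))) ⟩
      j + (g ∸ j)                               ≡⟨ m+[n∸m]≡n (m+n≤o⇒m≤o j (head-fits j j≤L)) ⟩
      g                                         ∎
      where
      open ≡-Reasoning
      m+n≤o⇒n≤o∸m : ∀ {m n o} → m + n ≤ o → n ≤ o ∸ m
      m+n≤o⇒n≤o∸m {m} {n} {o} le = m+n≤o⇒m≤o∸n n (subst (_≤ o) (+-comm m n) le)
      head-fits : ∀ j → j ≤ L → j + (2 * j ∸ 1) ≤ g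
      head-fits zero _ = z≤n
      head-fits (suc j) j≤L = ≤-pred (≤-trans (subst (_≤ 4 * suc j) (cong suc (+-suc j _)) (*-monoˡ-≤ (suc j) (n≤1+n 3)))
                                              (≤-trans (*-monoʳ-≤ 4 j≤L) 4L≤))

    ∈-codes⁻ : ∀ {j w} → w ∈ codes L g j → ∃₂ λ x t → w ≡ x ++ t × x ∈ heads L j
      × t ∈ tails (tailLength j) (j ∸ (aT x + 2 * bT x))
    ∈-codes⁻ {j} w∈ with ∈-concatMap⁻′ (λ x → map (x ++_) (tails (tailLength j) (j ∸ (aT x + 2 * bT x)))) (heads L j) w∈
    ... | x , x∈ , p with ∈-map⁻ (x ++_) p
    ... | t , t∈ , eq = x , t , eq , x∈ , t∈

    codes-size : ∀ {j w} → j ≤ L → w ∈ codes L g j → length w + j ≡ g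
    codes-size {j} j≤L w∈ with ∈-codes⁻ {j} w∈
    ... | x , t , refl , x∈ , t∈ = begin
      length (x ++ t) + j               ≡⟨ cong (_+ j) (length-++ x) ⟩
      length x + length t + j           ≡⟨ cong₂ (λ h k → h + k + j) (proj₁ (∈-heads⁻ {L} {j} x∈)) (proj₁ (∈-tails⁻ (tailLength j) _ t∈)) ⟩
      (2 * j ∸ 1) + tailLength j + j    ≡⟨ +-comm _ j ⟩
      j + ((2 * j ∸ 1) + tailLength j)  ≡⟨ size-split j≤L ⟩
      g                                 ∎
      where open ≡-Reasoning

    ∈-words⁻ : ∀ {w} → w ∈ words L g → Word L g w
    ∈-words⁻ {w} w∈ with ∈-concatMap⁻′ (codes L g) (applyUpTo id (suc L)) w∈
    ... | j , j∈ , w∈j with ∈-upTo⁻ j∈ | ∈-codes⁻ {j} w∈j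
    ... | s≤s j≤L | x , t , refl , x∈ , t∈ with ∈-heads⁻ {L} {j} x∈ | ∈-tails⁻ (g ∸ j ∸ (2 * j ∸ 1)) _ t∈
    ... | len , no113 , le , bal | _ , at≡ , no3 = record
      { split = refl ; j≤L = j≤L ; size = codes-size j≤L w∈j ; balance = bal
      ; code = record
        { head-length = len ; no113 = no113 ; tail-no3 = no3
        ; weight = trans (cong (aT x + 2 * bT x +_) at≡) (m+[n∸m]≡n le)
        ; long = +-cancelˡ-≤ j _ _ (begin
            4 * j                       ≤⟨ *-monoʳ-≤ 4 j≤L ⟩
            4 * L                       ≤⟨ 4L≤ ⟩
            suc g                       ≡⟨ cong suc (codes-size j≤L w∈j) ⟨
            suc (length (x ++ t) + j)   ≡⟨ +-comm (mult (x ++ t)) j ⟩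
            j + mult (x ++ t)           ∎)
        } }
      where open ≤-Reasoning

    ∈-words⁺ : ∀ {w} → Word L g w → w ∈ words L g
    ∈-words⁺ {w} record { j = j ; x = x ; t = t ; split = refl ; j≤L = j≤L ; code = code ; size = size ; balance = balance } =
      ∈-concatMap⁺′ {f = codes L g} (∈-upTo⁺ (s≤s j≤L))
        (∈-concatMap⁺′ {f = λ x → map (x ++_) (tails (tailLength j) (j ∸ (aT x + 2 * bT x)))}
          (∈-heads⁺ {L} {j} head-length no113 (subst (aT x + 2 * bT x ≤_) weight (m≤m+n _ (aT t))) balance)
          (∈-map⁺ (x ++_) (subst₂ (λ n r → t ∈ tails n r) tail-length tail-weight (∈-tails⁺ tail-no3))))
      where
      open Code code
      open ≡-Reasoning
      tail-weight : aT t ≡ j ∸ (aT x + 2 * bT x)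
      tail-weight = sym (trans (cong (_∸ (aT x + 2 * bT x)) (sym weight)) (m+n∸m≡n (aT x + 2 * bT x) (aT t)))
      tail-length : length t ≡ tailLength j
      tail-length = +-cancelˡ-≡ (2 * j ∸ 1) _ _ (+-cancelˡ-≡ j _ _ (begin
        j + ((2 * j ∸ 1) + length t)     ≡⟨ cong (λ h → j + (h + length t)) head-length ⟨
        j + (length x + length t)        ≡⟨ cong (j +_) (length-++ x) ⟨
        j + length (x ++ t)              ≡⟨ +-comm j _ ⟩
        length (x ++ t) + j              ≡⟨ size ⟩
        g                                ≡⟨ size-split j≤L ⟨
        j + ((2 * j ∸ 1) + tailLength j) ∎))

    heads-unique : ∀ j → Unique (heads L j)
    heads-unique j = Uniqueₚ.filter⁺ (λ x → aT x + bT x + L ≟ 2 * j + cT x)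
      (Uniqueₚ.filter⁺ (λ x → Boolₚ._≟_ (not (has113 x) ∧ ⌊ aT x + 2 * bT x ≤? j ⌋) true) (allTuples-unique (2 * j ∸ 1)))

    codes-unique : ∀ j → Unique (codes L g j)
    codes-unique j = concatMap-unique (take (2 * j ∸ 1)) (heads-unique j)
      (λ {x} _ → Uniqueₚ.map⁺ (++-cancelˡ x _ _) (tails-unique (tailLength j) (j ∸ (aT x + 2 * bT x))))
      (λ {x} x∈ w∈ → case ∈-map⁻ (x ++_) w∈ of λ { (t , _ , refl) →
        trans (cong (λ h → take h (x ++ t)) (sym (proj₁ (∈-heads⁻ {L} {j} x∈)))) (take-++-length x t) })
      where
      take-++-length : ∀ (x t : List D) → take (length x) (x ++ t) ≡ x
      take-++-length [] t = refl
      take-++-length (d ∷ x) t = cong (d ∷_) (take-++-length x t)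

    -- The length of a word determines its block, as j = g - `length w`; within a block the head is
    -- a prefix of fixed length.
    words-unique : Unique (words L g)
    words-unique = concatMap-unique (λ w → g ∸ length w) (Uniqueₚ.upTo⁺ (suc L)) (λ {j} _ → codes-unique j)
      (λ {j} {w} j∈ w∈ → trans (cong (_∸ length w) (sym (codes-size (≤-pred (∈-upTo⁻ j∈)) w∈))) (m+n∸m≡n (length w) j))

    -- At j = 0 the tail has length g rather than g + 1, but both binomials choose 0 entries.
    binomial : ∀ j r → tailLength j C (j ∸ r) ≡ (g + 1 ∸ 3 * j) C (j ∸ r)
    binomial zero r = begin
      g C (0 ∸ r)       ≡⟨ cong (g C_) (0∸n≡0 r) ⟩
      g C 0             ≡⟨ trans (sym (length-tails g 0)) (trans (one g) (trans (sym (one (g + 1))) (length-tails (g + 1) 0))) ⟩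
      (g + 1) C 0       ≡⟨ cong ((g + 1) C_) (0∸n≡0 r) ⟨
      (g + 1) C (0 ∸ r) ∎
      where
      open ≡-Reasoning
      one : ∀ n → length (tails n 0) ≡ 1
      one zero = refl
      one (suc n) = trans (length-map (d1 ∷_) (tails n 0)) (one n)
    binomial (suc j) r = cong (_C (suc j ∸ r)) (begin
      g ∸ suc j ∸ (2 * suc j ∸ 1)           ≡⟨ ∸-+-assoc g (suc j) (2 * suc j ∸ 1) ⟩
      suc g ∸ suc (suc j + (2 * suc j ∸ 1)) ≡⟨ cong₂ _∸_ (+-comm 1 g) (cong suc (sym (+-suc j _))) ⟩
      g + 1 ∸ 3 * suc j                     ∎)
      where open ≡-Reasoning

    length-codes : ∀ j → length (codes L g j) ≡ inner L g j
    length-codes j = trans (length-concatMap _ (heads L j)) (sum-map-cong (heads L j) λ {x} _ →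
      trans (length-map (x ++_) (tails (tailLength j) (j ∸ (aT x + 2 * bT x))))
        (trans (length-tails (tailLength j) (j ∸ (aT x + 2 * bT x))) (binomial j (aT x + 2 * bT x))))

    length-words : length (words L g) ≡ rhs L g
    length-words = trans (length-concatMap (codes L g) (applyUpTo id (suc L))) (sum-map-cong (applyUpTo id (suc L)) λ {j} _ → length-codes j)

  -- The count in natural-number parameters

  card-by-genus-and-EmbDim : ∀ {L g} → 4 * L ≤ suc g →
    HasCard (λ G → IsNumSgpGaps G × genus G ≡ g × ∃ λ e → EmbDim G e × e + L ≡ suc g) (rhs L g)
  card-by-genus-and-EmbDim {L} {g} 4L≤ =
    map gaps (words L g) , Uniqueₚ.map⁺ gaps-injective words-unique , (λ G → mk⇔ to from)
    , trans (length-map gaps (words L g)) length-words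
    where
    open Enumeration {L} {g} 4L≤
    to : ∀ {G} → G ∈ map gaps (words L g) → IsNumSgpGaps G × genus G ≡ g × ∃ λ e → EmbDim G e × e + L ≡ suc g
    to G∈ with ∈-map⁻ gaps G∈
    ... | w , w∈ , refl = Word-gaps (∈-words⁻ w∈)
    from : ∀ {G} → IsNumSgpGaps G × genus G ≡ g × (∃ λ e → EmbDim G e × e + L ≡ suc g) → G ∈ map gaps (words L g)
    from {G} (sgp , gen , e , emb , e+L) =
      let n , below , m∉ , n≤ = multiplicity G
          open Converse 4L≤ sgp gen emb e+L below m∉ n≤
      in subst (_∈ map gaps (words L g)) gaps-word (∈-map⁺ gaps (∈-words⁺ word))

  HasCard-resp-⇔ : {P Q : A → Set} {n : ℕ} → (∀ x → P x ⇔ Q x) → HasCard P n → HasCard Q n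
  HasCard-resp-⇔ P⇔Q (xs , uxs , xs⇔ , len) = xs , uxs , (λ x → P⇔Q x ⇔-∘ xs⇔ x) , len

open KunzWords using (card-by-genus-and-EmbDim; HasCard-resp-⇔)
open import Data.Nat using (ℕ)
open import Data.Integer using (ℤ; +_; -[1+_]; _+_; _-_; _*_; _≤_; ∣_∣)
open import Data.List using (List)
open import Data.Product using (_×_)
import Data.Product
open import Relation.Binary.PropositionalEquality using (_≡_)
open import Algebra.Bundles using (AbelianGroup)
open import Algebra.Properties.Group using (//-rightDividesˡ; //-rightDividesʳ)
open import Data.Integer.Properties using (+-0-abelianGroup; +-injective; drop‿+≤+; pos-*)
import Data.Nat as ℕ
import Data.Nat.Properties as ℕₚ
open import Data.Nat.Tactic.RingSolver using (solve-∀)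
open import Data.Product using (map₂)
open import Function.Bundles using (_⇔_; mk⇔; Equivalence)
open import Relation.Binary.PropositionalEquality using (refl; sym; trans; cong; subst)

-- Passage to the integer parameter l, with L = l + 1

nonneg-bound : ∀ k g → (+ 4) * + k + + 3 ≤ + g → 4 ℕ.* (k ℕ.+ 1) ℕ.≤ ℕ.suc g
nonneg-bound k g h = subst (ℕ._≤ ℕ.suc g) (rearrange k)
  (ℕ.s≤s (drop‿+≤+ (subst (λ z → z + + 3 ≤ + g) (sym (pos-* 4 k)) h)))
  where
  rearrange : ∀ k → ℕ.suc (4 ℕ.* k ℕ.+ 3) ≡ 4 ℕ.* (k ℕ.+ 1)
  rearrange = solve-∀

-- For l ≥ 0 the unit in L = l + 1 cancels against that in g + 1. For l = -1 one has L = 0, and g -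
-- l computes to g + 1.
difference⇔sum : ∀ l → -[1+ 0 ] ≤ l → ∀ {e g} → (e ℕ.+ ∣ l + + 1 ∣ ≡ ℕ.suc g) ⇔ (+ e ≡ + g - l)
difference⇔sum (+ k) _ {e} {g} = mk⇔
  (λ eq → trans (sym (//-rightDividesʳ (AbelianGroup.group +-0-abelianGroup) (+ k) (+ e))) (cong (λ n → + n - + k) (ℕₚ.suc-injective (trans (sym (assoc e k)) eq))))
  (λ eq → trans (assoc e k) (cong ℕ.suc (+-injective (trans (cong (_+ + k) eq) (//-rightDividesˡ (AbelianGroup.group +-0-abelianGroup) (+ k) (+ g))))))
  where
  assoc : ∀ e k → e ℕ.+ (k ℕ.+ 1) ≡ ℕ.suc (e ℕ.+ k)
  assoc = solve-∀
difference⇔sum -[1+ 0 ] _ {e} {g} = mk⇔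
  (λ eq → cong +_ (trans (sym (ℕₚ.+-identityʳ e)) (trans eq (ℕₚ.+-comm 1 g))))
  (λ eq → trans (ℕₚ.+-identityʳ e) (trans (+-injective eq) (ℕₚ.+-comm g 1)))
difference⇔sum -[1+ ℕ.suc _ ] (_≤_.-≤- ())

shifted-bound : ∀ l → -[1+ 0 ] ≤ l → ∀ g → (+ 4) * l + + 3 ≤ + g → 4 ℕ.* ∣ l + + 1 ∣ ℕ.≤ ℕ.suc g
shifted-bound (+ k) _ g h = nonneg-bound k g h
shifted-bound -[1+ 0 ] _ g _ = ℕ.z≤n
shifted-bound -[1+ ℕ.suc _ ] (_≤_.-≤- ())

theorem8p10 : (l : ℤ) → -[1+ 0 ] ≤ l → (g : ℕ) → (+ 4) * l + + 3 ≤ + g →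
    HasCard (λ (G : List ℕ) → IsNumSgpGaps G × genus G ≡ g
                × (Data.Product.Σ ℕ λ e → EmbDim G e × + e ≡ + g - l))
            (rhs ∣ l + + 1 ∣ g)
theorem8p10 l -1≤l g h = HasCard-resp-⇔
  -- The two descriptions of a semigroup differ only in the innermost component, the equation
  -- relating e, g and l.
  (λ _ → mk⇔
    (map₂ (map₂ (map₂ (map₂ (Equivalence.to (difference⇔sum l -1≤l))))))
    (map₂ (map₂ (map₂ (map₂ (Equivalence.from (difference⇔sum l -1≤l)))))))
  (card-by-genus-and-EmbDim (shifted-bound l -1≤l g h))
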